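{- Let $G$ be a bipartite optimal graph in $\mathfrak{B}_{n,m}$ which is a difference graph with vertex-eigenvector $(x_1,x_2,\ldots,x_k;y_1,y_2,\ldots,y_k)$, where $k\ge 3$. Suppose that $\sum_{i=1}^{k}x_i\ge\sum_{j=1}^{k-1}y_j$. Then $x_1\ge y_1+y_2$.
   Context: All graphs are finite, simple and undirected. For a graph $G$ on $n$ vertices with adjacency matrix $\mathbf{A}(G)$, write $\det(\lambda I-\mathbf{A}(G))=\sum_{i=0}^n \mathbf{a}_i(G)\lambda^{n-i}$, so $\mathbf{a}_4(G)$ is the coefficient of $\lambda^{n-4}$. $\mathfrak{B}_{n,m}$ is the set of connected bipartite graphs with $n$ vertices and $m$ edges; $G\in\mathfrak{B}_{n,m}$ is bipartite optimal if $\mathbf{a}_4(G)=\min\{\mathbf{a}_4(H):H\in\mathfrak{B}_{n,m}\}$. A difference graph with vertex bipartition $(X_1,\ldots,X_k;Y_1,\ldots,Y_k)$ is a graph whose vertex set is the disjoint union of nonempty sets $X_1,\ldots,X_k,Y_1,\ldots,Y_k$ and in which $x\in X_i$ and $y\in Y_j$ are adjacent if and only if $i+j\le k+1$, with no other edges. Its vertex-eigenvector is $(x_1,\ldots,x_k;y_1,\ldots,y_k)$ with $x_i=|X_i|$, $y_i=|Y_i|$. -}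

module Defs where

open import Data.Nat using (ℕ; zero; suc; _+_; _<ᵇ_; _∸_; _≤ᵇ_)
open import Data.Integer as ℤ using (ℤ; 0ℤ; 1ℤ; -_)
open import Data.Fin using (Fin; zero; suc; toℕ; punchIn; _≟_)
open import Data.Bool using (Bool; true; false; if_then_else_; _∧_)
open import Data.List using (List; []; _∷_; map; allFin)
open import Data.Nat.ListAction using (sum)
open import Data.Sum using (_⊎_; inj₁; inj₂)
open import Data.Product using (Σ; ∃; _×_)
open import Relation.Nullary.Decidable using (⌊_⌋)
open import Relation.Binary.PropositionalEquality using (_≡_; _≢_)

record Graph (n : ℕ) : Set where
  field
    adj    : Fin n → Fin n → Bool
    adjSym : ∀ u v → adj u v ≡ adj v u
    loopless : ∀ u → adj u u ≡ false
open Graph public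

edgeCount : ∀ {n} → Graph n → ℕ
edgeCount {n} G =
  sum (map (λ u → sum (map (λ v → if adj G u v ∧ (toℕ u <ᵇ toℕ v) then 1 else 0)
                            (allFin n)))
           (allFin n))

data Walk {n} (G : Graph n) : Fin n → Fin n → Set where
  here : ∀ {u} → Walk G u u
  step : ∀ {u w v} → adj G u w ≡ true → Walk G w v → Walk G u v

Connected : ∀ {n} → Graph n → Set
Connected {n} G = ∀ (u v : Fin n) → Walk G u v

Bipartite : ∀ {n} → Graph n → Set
Bipartite {n} G = Σ (Fin n → Bool) λ c → ∀ u v → adj G u v ≡ true → c u ≢ c v

InB : (n m : ℕ) → Graph n → Set
InB n m G = Connected G × Bipartite G × edgeCount G ≡ m

-- Polynomials over ℤ as little-endian coefficient lists

Poly : Set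
Poly = List ℤ

_+P_ : Poly → Poly → Poly
[] +P q = q
(a ∷ p) +P [] = a ∷ p
(a ∷ p) +P (b ∷ q) = (a ℤ.+ b) ∷ (p +P q)

scaleP : ℤ → Poly → Poly
scaleP c p = map (c ℤ.*_) p

_*P_ : Poly → Poly → Poly
[] *P q = []
(a ∷ p) *P q = scaleP a q +P (0ℤ ∷ (p *P q))

oneP : Poly
oneP = 1ℤ ∷ []

coeff : Poly → ℕ → ℤ
coeff [] _ = 0ℤ
coeff (a ∷ p) zero = a
coeff (a ∷ p) (suc i) = coeff p i

sumP : ∀ {n} → (Fin n → Poly) → Poly
sumP {zero} f = []
sumP {suc n} f = f zero +P sumP (λ i → f (suc i))

signP : ℕ → Poly → Poly
signP zero p = p
signP (suc zero) p = scaleP (- 1ℤ) p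
signP (suc (suc j)) p = signP j p

det : ∀ n → (Fin n → Fin n → Poly) → Poly
det zero M = oneP
det (suc n) M =
  sumP (λ j → signP (toℕ j) (M zero j *P det n (λ r c → M (suc r) (punchIn j c))))

charMatrix : ∀ {n} → Graph n → Fin n → Fin n → Poly
charMatrix G u v with ⌊ u ≟ v ⌋
... | true  = 0ℤ ∷ 1ℤ ∷ []
... | false = (if adj G u v then - 1ℤ else 0ℤ) ∷ []

charPoly : ∀ {n} → Graph n → Poly
charPoly {n} G = det n (charMatrix G)

aCoeff : ∀ {n} → ℕ → Graph n → ℤ
aCoeff {n} i G = if i ≤ᵇ n then coeff (charPoly G) (n ∸ i) else 0ℤ

a4 : ∀ {n} → Graph n → ℤ
a4 = aCoeff 4

BipartiteOptimal : (n m : ℕ) → Graph n → Set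
BipartiteOptimal n m G = InB n m G × (∀ (H : Graph n) → InB n m H → a4 G ℤ.≤ a4 H)

-- Difference graphs.  part v = inj₁ i means v ∈ X_{i+1}, inj₂ j means v ∈ Y_{j+1}
-- (0-indexed Fin k).  X_{i+1} ~ Y_{j+1} iff (i+1)+(j+1) ≤ k+1 iff i + j < k.

diffAdj : (k : ℕ) → Fin k ⊎ Fin k → Fin k ⊎ Fin k → Bool
diffAdj k (inj₁ i) (inj₂ j) = (toℕ i + toℕ j) <ᵇ k
diffAdj k (inj₂ j) (inj₁ i) = (toℕ i + toℕ j) <ᵇ k
diffAdj k (inj₁ _) (inj₁ _) = false
diffAdj k (inj₂ _) (inj₂ _) = false

record DifferenceGraph {n} (G : Graph n) (k : ℕ) : Set where
  field
    part      : Fin n → Fin k ⊎ Fin k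
    nonemptyX : ∀ i → ∃ λ v → part v ≡ inj₁ i
    nonemptyY : ∀ j → ∃ λ v → part v ≡ inj₂ j
    adjRule   : ∀ u v → adj G u v ≡ diffAdj k (part u) (part v)
open DifferenceGraph public

inX : ∀ {k} → ℕ → Fin k ⊎ Fin k → Bool
inX i (inj₁ j) = ⌊ Data.Nat._≟_ (suc (toℕ j)) i ⌋
inX i (inj₂ _) = false

inY : ∀ {k} → ℕ → Fin k ⊎ Fin k → Bool
inY i (inj₁ _) = false
inY i (inj₂ j) = ⌊ Data.Nat._≟_ (suc (toℕ j)) i ⌋

-- vertex-eigenvector entries, 1-indexed: x D i = |X_i|, y D i = |Y_i|
x : ∀ {n k} {G : Graph n} → DifferenceGraph G k → ℕ → ℕ
x {n} D i = sum (map (λ v → if inX i (part D v) then 1 else 0) (allFin n))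

y : ∀ {n k} {G : Graph n} → DifferenceGraph G k → ℕ → ℕ
y {n} D i = sum (map (λ v → if inY i (part D v) then 1 else 0) (allFin n))

Σ₁ : ℕ → (ℕ → ℕ) → ℕ
Σ₁ zero f = 0
Σ₁ (suc k) f = Σ₁ k f + f (suc k)

{-# OPTIONS --safe #-}

-- Newton's identities, read off from the cofactor recursion for the characteristic polynomial, give
-- 8 a₄ = (2m)² − 2 tr A⁴, so an optimal graph maximises the number of closed 4-walks.  If the
-- neighbourhoods on one side of a bipartite graph are nested, with row lengths (degrees) ℓ, this
-- number is 2 Σ min(ℓᵤ, ℓᵥ)², the sum running over all pairs of rows.
--
-- Let p = Σ xᵢ, q₀ = Σ_{j<k} yⱼ.  Replacing the y_k columns of height x₁ by y_k rows of length x₁ keeps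
-- n and m, and by optimality gives Σᵢ xᵢ min(x₁, ℓᵢ)² ≤ x₁² q₀ for the shortened rows ℓ.  Hence
--   (B) x₁ ≤ y₁ + y₂ implies p − x_k ≤ q₀,   (C) x₁ ≤ y₁ implies p ≤ q₀,
-- as well as the transposed statements (B′), (C′).  Replacing also the columns Y_{k−1} by rows of length
-- x₁ + x₂ gives (E) x₁ + x₂ ≤ y₁ implies p ≤ q₀ − y_{k−1}.  If x₁ < y₁ + y₂ and p ≥ q₀, then y₁ ≤ x₁
-- contradicts (B) and (C′), x₁ + x₂ ≤ y₁ contradicts (E), and x₁ ≤ y₁ ≤ x₁ + x₂ contradicts (C) and (B′).

module Submission where

open import Defs
open import Data.Nat using (ℕ; _+_; _∸_; _≤_; _≥_)
open import Data.Nat as ℕ using (zero; suc; _*_; _⊓_; _<_; _<ᵇ_; z≤n; s≤s)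
import Data.Nat.Properties as ℕ
open import Data.Nat.Divisibility using () renaming (_∣_ to _∣ℕ_; ∣⇒≤ to ∣ℕ⇒≤)
import Data.Nat.ListAction as ListAction
open import Data.Nat.Tactic.RingSolver using () renaming (solve-∀ to solveℕ-∀)
open import Data.Integer as ℤ using (ℤ; 0ℤ; 1ℤ; -_; +_)
import Data.Integer.Properties as ℤ
open import Data.Integer.Divisibility.Signed using (divides; ∣⇒∣ᵤ)
open import Data.Integer.Tactic.RingSolver using (solve-∀)
open import Data.Fin as Fin using (Fin; zero; suc; toℕ; fromℕ<; punchIn; lift; splitAt; _↑ˡ_; _↑ʳ_)
open import Data.Fin.Properties using (toℕ-injective; toℕ<n; toℕ-fromℕ<; splitAt-↑ˡ; splitAt-↑ʳ)
open import Data.List as List using ([]; _∷_; allFin)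
import Data.List.Properties as List
open import Data.Bool as Bool using (Bool; true; false; if_then_else_; not; _∧_)
open import Data.Empty using (⊥; ⊥-elim)
open import Data.Unit using (⊤; tt)
open import Data.Sum as Sum using (_⊎_; inj₁; inj₂; [_,_]′)
open import Data.Product using (_,_; _×_; ∃; proj₁; proj₂)
open import Function using (_∘_)
open import Relation.Nullary using (yes; no)
open import Relation.Nullary.Decidable using (⌊_⌋; isYes≗does; dec-true; dec-false)
open import Relation.Binary using (tri<; tri≈; tri>)
open import Relation.Binary.PropositionalEquality hiding ([_])
open import Algebra.Properties.Semiring.Sum ℤ.+-*-semiring
  using (sum; sum-cong-≗; ∑-distrib-+; ∑-comm; *-distribˡ-sum; *-distribʳ-sum)
open import Algebra.Properties.Semiring.Sum ℕ.+-*-semiring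
  using () renaming (sum to ∑; sum-cong-≗ to ∑-cong; ∑-distrib-+ to ∑-+; ∑-comm to ∑-swap;
                     *-distribˡ-sum to ∑-*ˡ; *-distribʳ-sum to ∑-*ʳ)

open ≡-Reasoning

-- Polynomials: coefficients and evaluation

-- The link from determinant to walks is the vector C of cofactors of row 0. Replacing row 0 by a
-- copy of row k ≥ 1 makes the determinant vanish, so λ C_k = Σ_j A_kj C_j. Read from the leading
-- coefficient downwards, this recursion expresses the coefficients through powers of the matrix
-- without its first row and column, and the trace identities follow by induction on the size. Equal
-- rows are treated over ℤ, at positive integers λ, since coefficient lists obey the ring laws only
-- up to trailing zeros.
--
-- The exchange is tractable because closed 4-walks of a bipartite graph can be counted by pairs of
-- rows or by pairs of columns. With s = x₁ and t = y_k, the t columns of height s and the t rows of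
-- length s each contribute t²s² among themselves, and the retained part is common to both graphs.
-- Only mixed pairs differ: 2t s² q₀ against 2t Σ xᵢ min(s, ℓᵢ)². Optimality compares these two, and
-- 2t cancels. The new rows must fit into the remaining columns: k ≥ 3 gives y₁ + y₂ ≤ q₀ for (B),
-- and y₁ ≤ q₀ - y_{k-1} for (E).

sgn : ℕ → ℤ
sgn zero = 1ℤ
sgn (suc zero) = - 1ℤ
sgn (suc (suc j)) = sgn j

sgn-suc : ∀ j → sgn (suc j) ≡ - sgn j
sgn-suc zero = refl
sgn-suc (suc zero) = refl
sgn-suc (suc (suc j)) = sgn-suc j

coeff-+P : ∀ p q i → coeff (p +P q) i ≡ coeff p i ℤ.+ coeff q i
coeff-+P [] q i = sym (ℤ.+-identityˡ _)
coeff-+P (a ∷ p) [] i = sym (ℤ.+-identityʳ _)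
coeff-+P (a ∷ p) (b ∷ q) zero = refl
coeff-+P (a ∷ p) (b ∷ q) (suc i) = coeff-+P p q i

coeff-scaleP : ∀ c p i → coeff (scaleP c p) i ≡ c ℤ.* coeff p i
coeff-scaleP c [] i = sym (ℤ.*-zeroʳ c)
coeff-scaleP c (a ∷ p) zero = refl
coeff-scaleP c (a ∷ p) (suc i) = coeff-scaleP c p i

coeff-signP : ∀ j p i → coeff (signP j p) i ≡ sgn j ℤ.* coeff p i
coeff-signP zero p i = sym (ℤ.*-identityˡ _)
coeff-signP (suc zero) p i = coeff-scaleP (- 1ℤ) p i
coeff-signP (suc (suc j)) p i = coeff-signP j p i

coeff-sumP : ∀ {n} (f : Fin n → Poly) i → coeff (sumP f) i ≡ sum (λ j → coeff (f j) i)
coeff-sumP {zero} f i = refl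
coeff-sumP {suc n} f i =
  trans (coeff-+P (f zero) _ i) (cong (ℤ._+_ (coeff (f zero) i)) (coeff-sumP (f ∘ suc) i))

coeff-0∷[] : ∀ i → coeff (0ℤ ∷ []) i ≡ 0ℤ
coeff-0∷[] zero = refl
coeff-0∷[] (suc i) = refl

coeff-const-*P : ∀ c p i → coeff ((c ∷ []) *P p) i ≡ c ℤ.* coeff p i
coeff-const-*P c p i = begin
  coeff (scaleP c p +P (0ℤ ∷ [])) i              ≡⟨ coeff-+P (scaleP c p) _ i ⟩
  coeff (scaleP c p) i ℤ.+ coeff (0ℤ ∷ []) i     ≡⟨ cong₂ ℤ._+_ (coeff-scaleP c p i) (coeff-0∷[] i) ⟩
  c ℤ.* coeff p i ℤ.+ 0ℤ                         ≡⟨ ℤ.+-identityʳ _ ⟩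
  c ℤ.* coeff p i                                ∎

coeff-cong-∷ : ∀ p q → (∀ i → coeff p i ≡ coeff q i) → ∀ i → coeff (0ℤ ∷ p) i ≡ coeff (0ℤ ∷ q) i
coeff-cong-∷ p q h zero = refl
coeff-cong-∷ p q h (suc i) = h i

coeff-var-*P : ∀ p i → coeff ((0ℤ ∷ 1ℤ ∷ []) *P p) i ≡ coeff (0ℤ ∷ p) i
coeff-var-*P p i = begin
  coeff (scaleP 0ℤ p +P (0ℤ ∷ ((1ℤ ∷ []) *P p))) i
    ≡⟨ coeff-+P (scaleP 0ℤ p) _ i ⟩
  coeff (scaleP 0ℤ p) i ℤ.+ coeff (0ℤ ∷ ((1ℤ ∷ []) *P p)) i
    ≡⟨ cong₂ ℤ._+_ (trans (coeff-scaleP 0ℤ p i) (ℤ.*-zeroˡ (coeff p i)))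
         (coeff-cong-∷ ((1ℤ ∷ []) *P p) p
            (λ k → trans (coeff-const-*P 1ℤ p k) (ℤ.*-identityˡ _)) i) ⟩
  0ℤ ℤ.+ coeff (0ℤ ∷ p) i
    ≡⟨ ℤ.+-identityˡ _ ⟩
  coeff (0ℤ ∷ p) i ∎

eval : ℤ → Poly → ℤ
eval t [] = 0ℤ
eval t (a ∷ p) = a ℤ.+ t ℤ.* eval t p

eval-+P : ∀ t p q → eval t (p +P q) ≡ eval t p ℤ.+ eval t q
eval-+P t [] q = sym (ℤ.+-identityˡ _)
eval-+P t (a ∷ p) [] = sym (ℤ.+-identityʳ _)
eval-+P t (a ∷ p) (b ∷ q) = begin
  a ℤ.+ b ℤ.+ t ℤ.* eval t (p +P q)              ≡⟨ cong (λ z → a ℤ.+ b ℤ.+ t ℤ.* z) (eval-+P t p q) ⟩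
  a ℤ.+ b ℤ.+ t ℤ.* (eval t p ℤ.+ eval t q)      ≡⟨ lem a b t (eval t p) (eval t q) ⟩
  a ℤ.+ t ℤ.* eval t p ℤ.+ (b ℤ.+ t ℤ.* eval t q) ∎
  where
  lem : ∀ a b t u v → a ℤ.+ b ℤ.+ t ℤ.* (u ℤ.+ v) ≡ a ℤ.+ t ℤ.* u ℤ.+ (b ℤ.+ t ℤ.* v)
  lem = solve-∀

eval-scaleP : ∀ t c p → eval t (scaleP c p) ≡ c ℤ.* eval t p
eval-scaleP t c [] = sym (ℤ.*-zeroʳ c)
eval-scaleP t c (a ∷ p) = trans (cong (λ z → c ℤ.* a ℤ.+ t ℤ.* z) (eval-scaleP t c p)) (lem c a t (eval t p))
  where
  lem : ∀ c a t u → c ℤ.* a ℤ.+ t ℤ.* (c ℤ.* u) ≡ c ℤ.* (a ℤ.+ t ℤ.* u)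
  lem = solve-∀

eval-*P : ∀ t p q → eval t (p *P q) ≡ eval t p ℤ.* eval t q
eval-*P t [] q = sym (ℤ.*-zeroˡ (eval t q))
eval-*P t (a ∷ p) q = begin
  eval t (scaleP a q +P (0ℤ ∷ (p *P q)))
    ≡⟨ eval-+P t (scaleP a q) _ ⟩
  eval t (scaleP a q) ℤ.+ (0ℤ ℤ.+ t ℤ.* eval t (p *P q))
    ≡⟨ cong₂ (λ u v → u ℤ.+ (0ℤ ℤ.+ t ℤ.* v)) (eval-scaleP t a q) (eval-*P t p q) ⟩
  a ℤ.* eval t q ℤ.+ (0ℤ ℤ.+ t ℤ.* (eval t p ℤ.* eval t q))
    ≡⟨ lem a t (eval t p) (eval t q) ⟩
  (a ℤ.+ t ℤ.* eval t p) ℤ.* eval t q ∎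
  where
  lem : ∀ a t u v → a ℤ.* v ℤ.+ (0ℤ ℤ.+ t ℤ.* (u ℤ.* v)) ≡ (a ℤ.+ t ℤ.* u) ℤ.* v
  lem = solve-∀

eval-signP : ∀ t j p → eval t (signP j p) ≡ sgn j ℤ.* eval t p
eval-signP t zero p = sym (ℤ.*-identityˡ _)
eval-signP t (suc zero) p = eval-scaleP t (- 1ℤ) p
eval-signP t (suc (suc j)) p = eval-signP t j p

eval-sumP : ∀ t {n} (f : Fin n → Poly) → eval t (sumP f) ≡ sum (eval t ∘ f)
eval-sumP t {zero} f = refl
eval-sumP t {suc n} f = trans (eval-+P t (f zero) _) (cong (ℤ._+_ (eval t (f zero))) (eval-sumP t (f ∘ suc)))

-- A polynomial with constant term a that vanishes at every t > 0 has t ∣ a for every such t.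
divisible-by-all⇒0 : ∀ a (q : ℕ → ℤ) → (∀ n → a ℤ.+ + suc n ℤ.* q n ≡ 0ℤ) → a ≡ 0ℤ
divisible-by-all⇒0 a q h = ℤ.∣i∣≡0⇒i≡0 (small ℤ.∣ a ∣ (∣⇒∣ᵤ (divides (- q ℤ.∣ a ∣) a≡)))
  where
  t = + suc ℤ.∣ a ∣
  lem : ∀ a t u → a ≡ (- u) ℤ.* t ℤ.+ (a ℤ.+ t ℤ.* u)
  lem = solve-∀
  a≡ : a ≡ (- q ℤ.∣ a ∣) ℤ.* t
  a≡ = trans (lem a t (q ℤ.∣ a ∣)) (trans (cong (ℤ._+_ ((- q ℤ.∣ a ∣) ℤ.* t)) (h ℤ.∣ a ∣)) (ℤ.+-identityʳ _))
  small : ∀ m → suc m ∣ℕ m → m ≡ 0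
  small zero d = refl
  small (suc m) d = ⊥-elim (ℕ.1+n≰n (∣ℕ⇒≤ d))

-- The constant term vanishes by divisibility; then the factor t can be cancelled because only
-- points t > 0 are used, and the remaining coefficients form a shorter list with the same property.
eval≡0⇒coeff≡0 : ∀ p → (∀ n → eval (+ suc n) p ≡ 0ℤ) → ∀ i → coeff p i ≡ 0ℤ
eval≡0⇒coeff≡0 [] h i = refl
eval≡0⇒coeff≡0 (a ∷ p) h = go
  where
  a≡0 : a ≡ 0ℤ
  a≡0 = divisible-by-all⇒0 a (λ n → eval (+ suc n) p) h
  h′ : ∀ n → eval (+ suc n) p ≡ 0ℤ
  h′ n = ℤ.*-cancelˡ-≡ (+ suc n) (eval (+ suc n) p) 0ℤ
           (begin
             + suc n ℤ.* eval (+ suc n) p          ≡⟨ ℤ.+-identityˡ _ ⟨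
             0ℤ ℤ.+ + suc n ℤ.* eval (+ suc n) p   ≡⟨ cong (ℤ._+ _) a≡0 ⟨
             a ℤ.+ + suc n ℤ.* eval (+ suc n) p    ≡⟨ h n ⟩
             0ℤ                                    ≡⟨ ℤ.*-zeroʳ (+ suc n) ⟨
             + suc n ℤ.* 0ℤ                        ∎)
  go : ∀ i → coeff (a ∷ p) i ≡ 0ℤ
  go zero = a≡0
  go (suc i) = eval≡0⇒coeff≡0 p h′ i

-- Determinants over ℤ vanish when two rows agree

sum-neg : ∀ {n} (f : Fin n → ℤ) → sum (λ i → - f i) ≡ - sum f
sum-neg {zero} f = refl
sum-neg {suc n} f = trans (cong (ℤ._+_ (- f zero)) (sum-neg (f ∘ suc))) (sym (ℤ.neg-distrib-+ (f zero) _))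

sum-0 : ∀ {n} (f : Fin n → ℤ) → (∀ i → f i ≡ 0ℤ) → sum f ≡ 0ℤ
sum-0 {zero} f h = refl
sum-0 {suc n} f h = cong₂ ℤ._+_ (h zero) (sum-0 (f ∘ suc) (h ∘ suc))

-- The image of `det` under evaluation. Row exchanges are proved here, where the commutative ring
-- laws hold as equalities.
detℤ : ∀ n → (Fin n → Fin n → ℤ) → ℤ
detℤ zero M = 1ℤ
detℤ (suc n) M = sum (λ j → sgn (toℕ j) ℤ.* (M zero j ℤ.* detℤ n (λ r c → M (suc r) (punchIn j c))))

eval-det : ∀ t n M → eval t (det n M) ≡ detℤ n (λ r c → eval t (M r c))
eval-det t zero M = trans (cong (ℤ._+_ 1ℤ) (ℤ.*-zeroʳ t)) refl
eval-det t (suc n) M = trans (eval-sumP t (λ j → signP (toℕ j) (M zero j *P minor j))) (sum-cong-≗ λ j →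
  trans (eval-signP t (toℕ j) (M zero j *P minor j)) (cong (ℤ._*_ (sgn (toℕ j)))
  (trans (eval-*P t (M zero j) (minor j)) (cong (ℤ._*_ (eval t (M zero j))) (eval-det t n _)))))
  where
  minor : Fin (suc n) → Poly
  minor j = det n (λ r c → M (suc r) (punchIn j c))

detℤ-cong : ∀ n {M N : Fin n → Fin n → ℤ} → (∀ i j → M i j ≡ N i j) → detℤ n M ≡ detℤ n N
detℤ-cong zero h = refl
detℤ-cong (suc n) h = sum-cong-≗ λ j →
  cong (ℤ._*_ (sgn (toℕ j))) (cong₂ ℤ._*_ (h zero j) (detℤ-cong n λ r c → h (suc r) (punchIn j c)))

-- The expansion along the first two rows a and b, where Φ is the minor complementary to two
-- columns, given by the embedding of the remaining columns.
twoRows : ∀ {n} (a b : Fin (2 ℕ.+ n) → ℤ) (Φ : (Fin n → Fin (2 ℕ.+ n)) → ℤ) → ℤ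
twoRows a b Φ = sum λ j → sgn (toℕ j) ℤ.* (a j ℤ.*
  sum λ c → sgn (toℕ c) ℤ.* (b (punchIn j c) ℤ.* Φ (λ x → punchIn j (punchIn c x))))

private
  corner : ∀ {n} (a b : Fin (2 ℕ.+ n) → ℤ) (Φ : (Fin n → Fin (2 ℕ.+ n)) → ℤ) → ℤ
  corner a b Φ = a zero ℤ.* sum λ c → sgn (toℕ c) ℤ.* (b (suc c) ℤ.* Φ (λ x → suc (punchIn c x)))

  remainder : ∀ {n} (a b : Fin (2 ℕ.+ n) → ℤ) (Φ : (Fin n → Fin (2 ℕ.+ n)) → ℤ) → ℤ
  remainder {n} a b Φ = sum {suc n} λ j → sgn (toℕ j) ℤ.* (a (suc j) ℤ.*
    sum {n} λ c → sgn (toℕ c) ℤ.* (b (punchIn (suc j) (suc c)) ℤ.* Φ (λ x → punchIn (suc j) (punchIn (suc c) x))))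

  -- The terms are sorted by which row uses column 0: `a`, `b`, or neither. If `b` does, the column
  -- of `a` is some `suc j`, and this shift of the index by one gives the minus sign; if neither
  -- does, the two shifts cancel.
  twoRows-split : ∀ {n} a b (Φ : (Fin n → Fin (2 ℕ.+ n)) → ℤ) →
    twoRows a b Φ ≡ corner a b Φ ℤ.- corner b a Φ ℤ.+ remainder a b Φ
  twoRows-split {n} a b Φ = begin
    1ℤ ℤ.* corner a b Φ ℤ.+ sum later
      ≡⟨ cong₂ ℤ._+_ (ℤ.*-identityˡ (corner a b Φ)) (sum-cong-≗ later≡) ⟩
    corner a b Φ ℤ.+ sum (λ j → - (b zero ℤ.* u j) ℤ.+ v j)
      ≡⟨ cong (ℤ._+_ (corner a b Φ)) (∑-distrib-+ (λ j → - (b zero ℤ.* u j)) v) ⟩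
    corner a b Φ ℤ.+ (sum (λ j → - (b zero ℤ.* u j)) ℤ.+ sum v)
      ≡⟨ cong (λ z → corner a b Φ ℤ.+ (z ℤ.+ sum v))
           (trans (sum-neg (λ j → b zero ℤ.* u j)) (cong -_ (sym (*-distribˡ-sum (b zero) u)))) ⟩
    corner a b Φ ℤ.+ (- corner b a Φ ℤ.+ sum v)
      ≡⟨ ℤ.+-assoc (corner a b Φ) (- corner b a Φ) (sum v) ⟨
    corner a b Φ ℤ.- corner b a Φ ℤ.+ remainder a b Φ ∎
    where
    u v later : Fin (suc n) → ℤ
    u j = sgn (toℕ j) ℤ.* (a (suc j) ℤ.* Φ (λ x → suc (punchIn j x)))
    w : Fin (suc n) → Fin n → ℤ
    w j c = b (punchIn (suc j) (suc c)) ℤ.* Φ (λ x → punchIn (suc j) (punchIn (suc c) x))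
    inner : Fin (suc n) → ℤ
    inner j = sum λ c → sgn (toℕ c) ℤ.* w j c
    v j = sgn (toℕ j) ℤ.* (a (suc j) ℤ.* inner j)
    later j = sgn (suc (toℕ j)) ℤ.* (a (suc j) ℤ.* (1ℤ ℤ.* (b zero ℤ.* Φ (λ x → suc (punchIn j x)))
      ℤ.+ sum λ c → sgn (suc (toℕ c)) ℤ.* w j c))
    inner≡ : ∀ j → sum (λ c → sgn (suc (toℕ c)) ℤ.* w j c) ≡ - inner j
    inner≡ j = trans (sum-cong-≗ λ c → trans (cong (ℤ._* w j c) (sgn-suc (toℕ c)))
      (sym (ℤ.neg-distribˡ-* (sgn (toℕ c)) (w j c)))) (sum-neg λ c → sgn (toℕ c) ℤ.* w j c)
    lem : ∀ s a b Φ i → - s ℤ.* (a ℤ.* (1ℤ ℤ.* (b ℤ.* Φ) ℤ.+ - i)) ≡ - (b ℤ.* (s ℤ.* (a ℤ.* Φ))) ℤ.+ s ℤ.* (a ℤ.* i)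
    lem = solve-∀
    later≡ : ∀ j → later j ≡ - (b zero ℤ.* u j) ℤ.+ v j
    later≡ j = trans (cong₂ (λ s i → s ℤ.* (a (suc j) ℤ.* (1ℤ ℤ.* (b zero ℤ.* Φ (λ x → suc (punchIn j x))) ℤ.+ i)))
      (sgn-suc (toℕ j)) (inner≡ j)) (lem (sgn (toℕ j)) (a (suc j)) (b zero) _ (inner j))

  remainder-suc : ∀ {n} a b (Φ : (Fin (suc n) → Fin (3 ℕ.+ n)) → ℤ) →
    (∀ e f → e ≗ f → Φ e ≡ Φ f) →
    remainder a b Φ ≡ twoRows (a ∘ suc) (b ∘ suc) (Φ ∘ lift 1)
  remainder-suc a b Φ Φ-cong = sum-cong-≗ λ j → cong (λ z → sgn (toℕ j) ℤ.* (a (suc j) ℤ.* z))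
    (sum-cong-≗ λ c → cong (λ z → sgn (toℕ c) ℤ.* (b (suc (punchIn j c)) ℤ.* z))
      (Φ-cong (λ x → punchIn (suc j) (punchIn (suc c) x)) (lift 1 (λ x → punchIn j (punchIn c x)))
        λ { zero → refl ; (suc x) → refl }))

  remainder-zero : ∀ a b Φ → remainder {zero} a b Φ ≡ 0ℤ
  remainder-zero a b Φ = sum-0 (λ j → sgn (toℕ j) ℤ.* (a (suc j) ℤ.* 0ℤ)) λ
    { zero → trans (ℤ.*-identityˡ (a (suc zero) ℤ.* 0ℤ)) (ℤ.*-zeroʳ (a (suc zero))) }

  cancel : ∀ p q r s → r ℤ.+ s ≡ 0ℤ → (p ℤ.- q ℤ.+ r) ℤ.+ (q ℤ.- p ℤ.+ s) ≡ 0ℤ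
  cancel p q r s h = trans (lem p q r s) h
    where
    lem : ∀ p q r s → (p ℤ.- q ℤ.+ r) ℤ.+ (q ℤ.- p ℤ.+ s) ≡ r ℤ.+ s
    lem = solve-∀

-- The two corners cancel under the exchange of `a` and `b`, and the remainder is the same expansion
-- with column 0 dropped, so both statements go by induction on the number of columns. `Φ` has to
-- respect pointwise equality because the column embeddings agree only pointwise.
twoRows-antisym : ∀ {n} a b (Φ : (Fin n → Fin (2 ℕ.+ n)) → ℤ) → (∀ e f → e ≗ f → Φ e ≡ Φ f) →
  twoRows a b Φ ℤ.+ twoRows b a Φ ≡ 0ℤ
remainder-antisym : ∀ {n} a b (Φ : (Fin n → Fin (2 ℕ.+ n)) → ℤ) → (∀ e f → e ≗ f → Φ e ≡ Φ f) →
  remainder a b Φ ℤ.+ remainder b a Φ ≡ 0ℤ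
twoRows-antisym a b Φ Φ-cong = trans (cong₂ ℤ._+_ (twoRows-split a b Φ) (twoRows-split b a Φ))
  (cancel (corner a b Φ) (corner b a Φ) _ _ (remainder-antisym a b Φ Φ-cong))
remainder-antisym {zero} a b Φ Φ-cong = cong₂ ℤ._+_ (remainder-zero a b Φ) (remainder-zero b a Φ)
remainder-antisym {suc n} a b Φ Φ-cong = trans
  (cong₂ ℤ._+_ (remainder-suc a b Φ Φ-cong) (remainder-suc b a Φ Φ-cong))
  (twoRows-antisym (a ∘ suc) (b ∘ suc) (Φ ∘ lift 1)
    λ e f h → Φ-cong (lift 1 e) (lift 1 f) λ { zero → refl ; (suc x) → cong suc (h x) })

swap₀₁ : ∀ {n} {A : Set} → (Fin (2 ℕ.+ n) → A) → Fin (2 ℕ.+ n) → A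
swap₀₁ M zero = M (suc zero)
swap₀₁ M (suc zero) = M zero
swap₀₁ M (suc (suc i)) = M (suc (suc i))

detℤ-swap : ∀ {n} M → detℤ (2 ℕ.+ n) M ℤ.+ detℤ (2 ℕ.+ n) (swap₀₁ M) ≡ 0ℤ
detℤ-swap {n} M = twoRows-antisym (M zero) (M (suc zero)) (λ e → detℤ n λ r c → M (suc (suc r)) (e c))
  λ e f h → detℤ-cong n λ r c → cong (M (suc (suc r))) (h c)

i+i≡0⇒i≡0 : ∀ i → i ℤ.+ i ≡ 0ℤ → i ≡ 0ℤ
i+i≡0⇒i≡0 (+ zero) h = refl

-- If rows 0 and 1 agree, the determinant is its own negative. Otherwise rows 0 and 1 are exchanged;
-- the equal pair then lies below the new row 0, and every minor of the expansion has equal rows.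
detℤ-equalRows : ∀ n M (k : Fin n) → (∀ j → M zero j ≡ M (suc k) j) → detℤ (suc n) M ≡ 0ℤ
detℤ-equalRows (suc n) M zero h = i+i≡0⇒i≡0 _ (trans
  (cong (ℤ._+_ (detℤ (2 ℕ.+ n) M)) (detℤ-cong (2 ℕ.+ n) {M} {swap₀₁ M} λ
    { zero j → h j ; (suc zero) j → sym (h j) ; (suc (suc i)) j → refl }))
  (detℤ-swap M))
detℤ-equalRows (suc n) M (suc k) h = begin
  detℤ (2 ℕ.+ n) M           ≡⟨ ℤ.+-identityʳ _ ⟨
  detℤ (2 ℕ.+ n) M ℤ.+ 0ℤ    ≡⟨ cong (ℤ._+_ (detℤ (2 ℕ.+ n) M)) swapped≡0 ⟨
  detℤ (2 ℕ.+ n) M ℤ.+ detℤ (2 ℕ.+ n) (swap₀₁ M) ≡⟨ detℤ-swap M ⟩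
  0ℤ ∎
  where
  swapped≡0 : detℤ (2 ℕ.+ n) (swap₀₁ M) ≡ 0ℤ
  swapped≡0 = sum-0 _ λ j → trans (cong (λ z → sgn (toℕ j) ℤ.* (M (suc zero) j ℤ.* z))
      (detℤ-equalRows n (λ r c → swap₀₁ M (suc r) (punchIn j c)) k (λ c → h (punchIn j c))))
    (trans (cong (ℤ._*_ (sgn (toℕ j))) (ℤ.*-zeroʳ (M (suc zero) j))) (ℤ.*-zeroʳ (sgn (toℕ j))))

-- Leading coefficients of the characteristic polynomial

det-cong : ∀ n {M N : Fin n → Fin n → Poly} → (∀ i j → M i j ≡ N i j) → det n M ≡ det n N
sumP-cong : ∀ {n} {f g : Fin n → Poly} → (∀ i → f i ≡ g i) → sumP f ≡ sumP g
sumP-cong {zero} h = refl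
sumP-cong {suc n} h = cong₂ _+P_ (h zero) (sumP-cong (h ∘ suc))
det-cong zero h = refl
det-cong (suc n) h = sumP-cong λ j →
  cong (signP (toℕ j)) (cong₂ _*P_ (h zero j) (det-cong n λ r c → h (suc r) (punchIn j c)))

data Entry : Poly → Set where
  linear-entry : Entry (0ℤ ∷ 1ℤ ∷ [])
  constant-entry : ∀ c → Entry (c ∷ [])

coeff-entry-*P-high : ∀ {p} → Entry p → ∀ q n → (∀ i → n ℕ.< i → coeff q i ≡ 0ℤ) →
  ∀ i → suc n ℕ.< i → coeff (p *P q) i ≡ 0ℤ
coeff-entry-*P-high linear-entry q n h (suc i) (ℕ.s≤s n<i) = trans (coeff-var-*P q (suc i)) (h i n<i)
coeff-entry-*P-high (constant-entry c) q n h i n<i = trans (coeff-const-*P c q i)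
  (trans (cong (ℤ._*_ c) (h i (ℕ.<-trans (ℕ.n<1+n n) n<i))) (ℤ.*-zeroʳ c))

coeff-det-high : ∀ n M → (∀ i j → Entry (M i j)) → ∀ i → n ℕ.< i → coeff (det n M) i ≡ 0ℤ
coeff-det-high zero M e (suc i) h = refl
coeff-det-high (suc n) M e i h = trans (coeff-sumP (λ j → signP (toℕ j) (M zero j *P minor j)) i)
  (sum-0 (λ j → coeff (signP (toℕ j) (M zero j *P minor j)) i) λ j →
    trans (coeff-signP (toℕ j) (M zero j *P minor j) i) (trans (cong (ℤ._*_ (sgn (toℕ j)))
      (coeff-entry-*P-high (e zero j) (minor j) n
        (coeff-det-high n _ λ r c → e (suc r) (punchIn j c)) i h))
      (ℤ.*-zeroʳ (sgn (toℕ j)))))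
  where
  minor : Fin (suc n) → Poly
  minor j = det n (λ r c → M (suc r) (punchIn j c))

-- Defined by recursion so that `charM A` without its first row and column is `charM (principal A)`
-- by computation.
δ : ∀ {n} → Fin n → Fin n → Bool
δ zero zero = true
δ zero (suc j) = false
δ (suc i) zero = false
δ (suc i) (suc j) = δ i j

-- Diagonal entries are λ and not λ - A i i, so this is λI - A only for a matrix with zero diagonal,
-- which is why `Hollow` accompanies it.
charM : ∀ {n} → (Fin n → Fin n → ℤ) → Fin n → Fin n → Poly
charM A i j = if δ i j then 0ℤ ∷ 1ℤ ∷ [] else (- A i j) ∷ []

Hollow : ∀ {n} → (Fin n → Fin n → ℤ) → Set
Hollow A = ∀ i → A i i ≡ 0ℤ

charM-entry : ∀ {n} (A : Fin n → Fin n → ℤ) i j → Entry (charM A i j)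
charM-entry A i j with δ i j
... | true = linear-entry
... | false = constant-entry (- A i j)

sum-δ : ∀ {n} (k : Fin n) (f : Fin n → ℤ) → sum (λ j → if δ k j then f j else 0ℤ) ≡ f k
sum-δ {suc n} zero f = trans (cong (ℤ._+_ (f zero)) (sum-0 {n} (λ _ → 0ℤ) (λ _ → refl))) (ℤ.+-identityʳ _)
sum-δ (suc k) f = trans (ℤ.+-identityˡ _) (sum-δ k (f ∘ suc))

δ-true : ∀ {n} (i j : Fin n) → δ i j ≡ true → i ≡ j
δ-true zero zero h = refl
δ-true (suc i) (suc j) h = cong suc (δ-true i j h)

coeff-charM-*P : ∀ {n} (A : Fin n → Fin n → ℤ) → Hollow A → ∀ k j p i →
  coeff (charM A k j *P p) i ≡ (if δ k j then coeff (0ℤ ∷ p) i else 0ℤ) ℤ.- A k j ℤ.* coeff p i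
coeff-charM-*P A hollow k j p i with δ k j in eq
... | false = trans (coeff-const-*P (- A k j) p i) (trans (sym (ℤ.neg-distribˡ-* (A k j) (coeff p i))) (sym (ℤ.+-identityˡ _)))
... | true with refl ← δ-true k j eq = begin
  coeff ((0ℤ ∷ 1ℤ ∷ []) *P p) i            ≡⟨ coeff-var-*P p i ⟩
  coeff (0ℤ ∷ p) i                         ≡⟨ ℤ.+-identityʳ _ ⟨
  coeff (0ℤ ∷ p) i ℤ.- 0ℤ ℤ.* coeff p i    ≡⟨ cong (λ z → coeff (0ℤ ∷ p) i ℤ.- z ℤ.* coeff p i) (hollow k) ⟨
  coeff (0ℤ ∷ p) i ℤ.- A k k ℤ.* coeff p i ∎

-- Coefficients are read from the top: coeff (shift d p) n is the coefficient of λ^(n ∸ d) in p,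
-- and 0 if d > n.
shift : ℕ → Poly → Poly
shift zero p = p
shift (suc d) p = 0ℤ ∷ shift d p

-- A linear relation between polynomials survives multiplication by λ^d. Reading all shifts at one
-- fixed index then turns the relation into a recursion in the depth d.
coeff-shift-linear : ∀ {n} p (a : Fin n → ℤ) (q : Fin n → Poly) → (∀ i → coeff (0ℤ ∷ p) i ≡ sum (λ j → a j ℤ.* coeff (q j) i)) →
  ∀ d i → coeff (shift (suc d) p) i ≡ sum (λ j → a j ℤ.* coeff (shift d (q j)) i)
coeff-shift-linear p a q h zero i = h i
coeff-shift-linear p a q h (suc d) zero = sym (sum-0 (λ j → a j ℤ.* 0ℤ) (λ j → ℤ.*-zeroʳ (a j)))
coeff-shift-linear p a q h (suc d) (suc i) = coeff-shift-linear p a q h d i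

coeff-shift-affine : ∀ {n} r p (a : Fin n → ℤ) (q : Fin n → Poly) → (∀ i → coeff r i ≡ coeff (0ℤ ∷ p) i ℤ.- sum (λ j → a j ℤ.* coeff (q j) i)) →
  ∀ d i → coeff (shift d r) i ≡ coeff (shift (suc d) p) i ℤ.- sum (λ j → a j ℤ.* coeff (shift d (q j)) i)
coeff-shift-affine r p a q h zero i = h i
coeff-shift-affine r p a q h (suc d) zero = sym (cong (λ z → 0ℤ ℤ.- z) (sum-0 (λ j → a j ℤ.* 0ℤ) (λ j → ℤ.*-zeroʳ (a j))))
coeff-shift-affine r p a q h (suc d) (suc i) = coeff-shift-affine r p a q h d i

module FirstRow {n} (A : Fin (suc n) → Fin (suc n) → ℤ) (hollow : Hollow A) where
  M : Fin (suc n) → Fin (suc n) → Poly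
  M = charM A

  minor cofactor : Fin (suc n) → Poly
  minor j = det n (λ r c → M (suc r) (punchIn j c))
  cofactor j = signP (toℕ j) (minor j)

  expand : Fin (suc n) → Poly
  expand k = sumP (λ j → signP (toℕ j) (M k j *P minor j))

  coeff-expand : ∀ k i → coeff (expand k) i ≡
    coeff (0ℤ ∷ cofactor k) i ℤ.- sum (λ j → A k j ℤ.* coeff (cofactor j) i)
  coeff-expand k i = begin
    coeff (expand k) i
      ≡⟨ coeff-sumP (λ j → signP (toℕ j) (M k j *P minor j)) i ⟩
    sum (λ j → coeff (signP (toℕ j) (M k j *P minor j)) i)
      ≡⟨ sum-cong-≗ term ⟩
    sum (λ j → (if δ k j then coeff (0ℤ ∷ cofactor j) i else 0ℤ) ℤ.+ - (A k j ℤ.* coeff (cofactor j) i))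
      ≡⟨ ∑-distrib-+ (λ j → if δ k j then coeff (0ℤ ∷ cofactor j) i else 0ℤ) (λ j → - (A k j ℤ.* coeff (cofactor j) i)) ⟩
    sum (λ j → if δ k j then coeff (0ℤ ∷ cofactor j) i else 0ℤ) ℤ.+ sum (λ j → - (A k j ℤ.* coeff (cofactor j) i))
      ≡⟨ cong₂ ℤ._+_ (sum-δ k (λ j → coeff (0ℤ ∷ cofactor j) i)) (sum-neg (λ j → A k j ℤ.* coeff (cofactor j) i)) ⟩
    coeff (0ℤ ∷ cofactor k) i ℤ.- sum (λ j → A k j ℤ.* coeff (cofactor j) i) ∎
    where
    coeff-0∷signP : ∀ j p i → coeff (0ℤ ∷ signP j p) i ≡ sgn j ℤ.* coeff (0ℤ ∷ p) i
    coeff-0∷signP j p zero = sym (ℤ.*-zeroʳ (sgn j))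
    coeff-0∷signP j p (suc i) = coeff-signP j p i
    lem : ∀ s a p → s ℤ.* (0ℤ ℤ.- a ℤ.* p) ≡ 0ℤ ℤ.- a ℤ.* (s ℤ.* p)
    lem = solve-∀
    lem′ : ∀ s q a p → s ℤ.* (q ℤ.- a ℤ.* p) ≡ s ℤ.* q ℤ.- a ℤ.* (s ℤ.* p)
    lem′ = solve-∀
    scaled : ∀ (b : Bool) s q a p → s ℤ.* ((if b then q else 0ℤ) ℤ.- a ℤ.* p)
      ≡ (if b then s ℤ.* q else 0ℤ) ℤ.- a ℤ.* (s ℤ.* p)
    scaled true = lem′
    scaled false s q = lem s
    term : ∀ j → coeff (signP (toℕ j) (M k j *P minor j)) i ≡
      (if δ k j then coeff (0ℤ ∷ cofactor j) i else 0ℤ) ℤ.+ - (A k j ℤ.* coeff (cofactor j) i)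
    term j = begin
      coeff (signP (toℕ j) (M k j *P minor j)) i
        ≡⟨ coeff-signP (toℕ j) (M k j *P minor j) i ⟩
      sgn (toℕ j) ℤ.* coeff (M k j *P minor j) i
        ≡⟨ cong (ℤ._*_ (sgn (toℕ j))) (coeff-charM-*P A hollow k j (minor j) i) ⟩
      sgn (toℕ j) ℤ.* ((if δ k j then coeff (0ℤ ∷ minor j) i else 0ℤ) ℤ.- A k j ℤ.* coeff (minor j) i)
        ≡⟨ scaled (δ k j) (sgn (toℕ j)) (coeff (0ℤ ∷ minor j) i) (A k j) (coeff (minor j) i) ⟩
      (if δ k j then sgn (toℕ j) ℤ.* coeff (0ℤ ∷ minor j) i else 0ℤ) ℤ.- A k j ℤ.* (sgn (toℕ j) ℤ.* coeff (minor j) i)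
        ≡⟨ cong₂ (λ u v → (if δ k j then u else 0ℤ) ℤ.- A k j ℤ.* v)
             (coeff-0∷signP (toℕ j) (minor j) i) (coeff-signP (toℕ j) (minor j) i) ⟨
      (if δ k j then coeff (0ℤ ∷ cofactor j) i else 0ℤ) ℤ.- A k j ℤ.* coeff (cofactor j) i ∎

  -- expand (suc k) is the determinant of charM A with row 0 replaced by a copy of row suc k.
  coeff-expand-suc : ∀ (k : Fin n) i → coeff (expand (suc k)) i ≡ 0ℤ
  coeff-expand-suc k = eval≡0⇒coeff≡0 (expand (suc k)) λ t →
    trans (eval-det (+ suc t) (suc n) N)
      (detℤ-equalRows n (λ r c → eval (+ suc t) (N r c)) k (λ j → refl))
    where
    N : Fin (suc n) → Fin (suc n) → Poly
    N zero c = M (suc k) c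
    N (suc r) c = M (suc r) c

  -- The cofactors of row 0 form column 0 of the adjugate, so (λI - A) C = det · e₀; this is one of
  -- its rows with right-hand side 0.
  coeff-0∷cofactor : ∀ (k : Fin n) i →
    coeff (0ℤ ∷ cofactor (suc k)) i ≡ sum (λ j → A (suc k) j ℤ.* coeff (cofactor j) i)
  coeff-0∷cofactor k i = ℤ.i-j≡0⇒i≡j _ _ (trans (sym (coeff-expand (suc k) i)) (coeff-expand-suc k i))

  cofactor-high : ∀ j → coeff (cofactor j) (suc n) ≡ 0ℤ
  cofactor-high j = trans (coeff-signP (toℕ j) (minor j) (suc n)) (trans (cong (ℤ._*_ (sgn (toℕ j)))
    (coeff-det-high n _ (λ r c → charM-entry A (suc r) (punchIn j c)) (suc n) (ℕ.n<1+n n)))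
    (ℤ.*-zeroʳ (sgn (toℕ j))))

top : ∀ {n} → ℕ → (Fin n → Fin n → ℤ) → ℤ
top {n} d A = coeff (shift d (det n (charM A))) n

principal : ∀ {n} → (Fin (suc n) → Fin (suc n) → ℤ) → Fin n → Fin n → ℤ
principal A i j = A (suc i) (suc j)

module TopRecursion {n} (A : Fin (suc n) → Fin (suc n) → ℤ) (hollow : Hollow A) where
  open FirstRow A hollow

  v : ℕ → Fin n → ℤ
  v d k = coeff (shift d (cofactor (suc k))) (suc n)

  -- Write a for column 0 below the diagonal and P for `principal A`. Cofactor 0 is the
  -- characteristic polynomial of P, so the vectors satisfy v_{d+2} = top_{d+1-1}(P) a + P v_{d+1},
  -- that is, with top_d(P) as coefficient of a. Starting from v₀ = v₁ = 0 this yields v₂ = a, v₃ =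
  -- P a and v₄ = top₂(P) a + P² a.
  v-suc : ∀ d k → v (suc d) k ≡ A (suc k) zero ℤ.* coeff (shift d (cofactor zero)) (suc n) ℤ.+ sum (λ j → principal A k j ℤ.* v d j)
  v-suc d k = coeff-shift-linear (cofactor (suc k)) (A (suc k)) cofactor (coeff-0∷cofactor k) d (suc n)

  -- This is row 0 of the same system. The factor λ in λ C₀ makes up for the smaller size of the
  -- principal submatrix, so the depth d stays the same.
  top-suc : ∀ d → top d A ≡ top d (principal A) ℤ.- sum (λ j → A zero (suc j) ℤ.* v d j)
  top-suc d = begin
    top d A
      ≡⟨ coeff-shift-affine (expand zero) (cofactor zero) (A zero) cofactor (coeff-expand zero) d (suc n) ⟩
    c ℤ.- (A zero zero ℤ.* coeff (shift d (cofactor zero)) (suc n) ℤ.+ s)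
      ≡⟨ cong (λ z → c ℤ.- (z ℤ.* coeff (shift d (cofactor zero)) (suc n) ℤ.+ s)) (hollow zero) ⟩
    c ℤ.- (0ℤ ℤ.+ s)
      ≡⟨ cong (λ z → c ℤ.- z) (ℤ.+-identityˡ s) ⟩
    c ℤ.- s ∎
    where
    c s : ℤ
    c = top d (principal A)
    s = sum (λ j → A zero (suc j) ℤ.* v d j)

  v0 : ∀ k → v 0 k ≡ 0ℤ
  v0 k = cofactor-high (suc k)

  v1 : ∀ k → v 1 k ≡ 0ℤ
  v1 k = trans (v-suc 0 k) (cong₂ ℤ._+_
    (trans (cong (ℤ._*_ (A (suc k) zero)) (cofactor-high zero)) (ℤ.*-zeroʳ (A (suc k) zero)))
    (sum-0 (λ j → principal A k j ℤ.* v 0 j) λ j → trans (cong (ℤ._*_ (principal A k j)) (v0 j)) (ℤ.*-zeroʳ (principal A k j))))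

  v2 : top 0 (principal A) ≡ 1ℤ → ∀ k → v 2 k ≡ A (suc k) zero
  v2 top0 k = begin
    v 2 k
      ≡⟨ v-suc 1 k ⟩
    A (suc k) zero ℤ.* top 0 (principal A) ℤ.+ sum (λ j → principal A k j ℤ.* v 1 j)
      ≡⟨ cong₂ (λ x y → A (suc k) zero ℤ.* x ℤ.+ y) top0
           (sum-0 (λ j → principal A k j ℤ.* v 1 j) λ j → trans (cong (ℤ._*_ (principal A k j)) (v1 j)) (ℤ.*-zeroʳ (principal A k j))) ⟩
    A (suc k) zero ℤ.* 1ℤ ℤ.+ 0ℤ
      ≡⟨ trans (ℤ.+-identityʳ _) (ℤ.*-identityʳ _) ⟩
    A (suc k) zero ∎

  v3 : top 0 (principal A) ≡ 1ℤ → top 1 (principal A) ≡ 0ℤ → ∀ k →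
    v 3 k ≡ sum (λ j → principal A k j ℤ.* A (suc j) zero)
  v3 top0 top1 k = begin
    v 3 k
      ≡⟨ v-suc 2 k ⟩
    A (suc k) zero ℤ.* top 1 (principal A) ℤ.+ sum (λ j → principal A k j ℤ.* v 2 j)
      ≡⟨ cong₂ (λ x y → A (suc k) zero ℤ.* x ℤ.+ y) top1 (sum-cong-≗ λ j → cong (ℤ._*_ (principal A k j)) (v2 top0 j)) ⟩
    A (suc k) zero ℤ.* 0ℤ ℤ.+ sum (λ j → principal A k j ℤ.* A (suc j) zero)
      ≡⟨ trans (cong (λ z → z ℤ.+ sum (λ j → principal A k j ℤ.* A (suc j) zero)) (ℤ.*-zeroʳ (A (suc k) zero))) (ℤ.+-identityˡ _) ⟩
    sum (λ j → principal A k j ℤ.* A (suc j) zero) ∎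

principal-hollow : ∀ {n} {A : Fin (suc n) → Fin (suc n) → ℤ} → Hollow A → Hollow (principal A)
principal-hollow hollow i = hollow (suc i)

top0≡1 : ∀ {n} (A : Fin n → Fin n → ℤ) → Hollow A → top 0 A ≡ 1ℤ
top0≡1 {zero} A hollow = refl
top0≡1 {suc n} A hollow = trans (top-suc 0) (cong₂ ℤ._-_ (top0≡1 (principal A) (principal-hollow {A = A} hollow))
  (sum-0 (λ j → A zero (suc j) ℤ.* v 0 j) λ j → trans (cong (ℤ._*_ (A zero (suc j))) (v0 j)) (ℤ.*-zeroʳ (A zero (suc j)))))
  where open TopRecursion A hollow

top1≡0 : ∀ {n} (A : Fin n → Fin n → ℤ) → Hollow A → top 1 A ≡ 0ℤ
top1≡0 {zero} A hollow = refl
top1≡0 {suc n} A hollow = trans (top-suc 1) (cong₂ ℤ._-_ (top1≡0 (principal A) (principal-hollow {A = A} hollow))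
  (sum-0 (λ j → A zero (suc j) ℤ.* v 1 j) λ j → trans (cong (ℤ._*_ (A zero (suc j))) (v1 j)) (ℤ.*-zeroʳ (A zero (suc j)))))
  where open TopRecursion A hollow

-- Traces of powers and Newton's identities

square : ∀ {n} → (Fin n → Fin n → ℤ) → Fin n → Fin n → ℤ
square A i k = sum (λ j → A i j ℤ.* A j k)

trace² : ∀ {n} → (Fin n → Fin n → ℤ) → ℤ
trace² A = sum (λ i → square A i i)

sum-assoc : ∀ {m n} (f : Fin m → ℤ) (g : Fin m → Fin n → ℤ) (h : Fin n → ℤ) →
  sum (λ k → sum (λ j → f j ℤ.* g j k) ℤ.* h k) ≡ sum (λ j → f j ℤ.* sum (λ k → g j k ℤ.* h k))
sum-assoc f g h = begin
  sum (λ k → sum (λ j → f j ℤ.* g j k) ℤ.* h k)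
    ≡⟨ sum-cong-≗ (λ k → *-distribʳ-sum (h k) (λ j → f j ℤ.* g j k)) ⟩
  sum (λ k → sum (λ j → f j ℤ.* g j k ℤ.* h k))
    ≡⟨ ∑-comm (λ k j → f j ℤ.* g j k ℤ.* h k) ⟩
  sum (λ j → sum (λ k → f j ℤ.* g j k ℤ.* h k))
    ≡⟨ sum-cong-≗ (λ j → trans (sum-cong-≗ λ k → ℤ.*-assoc (f j) (g j k) (h k))
         (sym (*-distribˡ-sum (f j) (λ k → g j k ℤ.* h k)))) ⟩
  sum (λ j → f j ℤ.* sum (λ k → g j k ℤ.* h k)) ∎

trace²-suc : ∀ {n} (B : Fin (suc n) → Fin (suc n) → ℤ) →
  trace² B ≡ B zero zero ℤ.* B zero zero ℤ.+ + 2 ℤ.* sum (λ j → B zero (suc j) ℤ.* B (suc j) zero) ℤ.+ trace² (principal B)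
trace²-suc B = begin
  B zero zero ℤ.* B zero zero ℤ.+ r ℤ.+ sum (λ i → B (suc i) zero ℤ.* B zero (suc i) ℤ.+ square (principal B) i i)
    ≡⟨ cong (ℤ._+_ (B zero zero ℤ.* B zero zero ℤ.+ r))
         (trans (∑-distrib-+ (λ i → B (suc i) zero ℤ.* B zero (suc i)) (λ i → square (principal B) i i))
                (cong (λ z → z ℤ.+ trace² (principal B)) (sum-cong-≗ λ i → ℤ.*-comm (B (suc i) zero) (B zero (suc i))))) ⟩
  B zero zero ℤ.* B zero zero ℤ.+ r ℤ.+ (r ℤ.+ trace² (principal B))
    ≡⟨ lem (B zero zero ℤ.* B zero zero) r (trace² (principal B)) ⟩
  B zero zero ℤ.* B zero zero ℤ.+ + 2 ℤ.* r ℤ.+ trace² (principal B) ∎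
  where
  r = sum (λ j → B zero (suc j) ℤ.* B (suc j) zero)
  lem : ∀ a r t → a ℤ.+ r ℤ.+ (r ℤ.+ t) ≡ a ℤ.+ + 2 ℤ.* r ℤ.+ t
  lem = solve-∀

trace²-cong : ∀ {n} {A B : Fin n → Fin n → ℤ} → (∀ i j → A i j ≡ B i j) → trace² A ≡ trace² B
trace²-cong h = sum-cong-≗ λ i → sum-cong-≗ λ j → cong₂ ℤ._*_ (h i j) (h j i)

-- Needed because the principal block of `square A` is a rank-one matrix, column 0 times row 0, plus
-- the square of `principal A`.
trace²-rankOne : ∀ {n} (a b : Fin n → ℤ) B →
  trace² (λ i j → a i ℤ.* b j ℤ.+ B i j) ≡
    sum (λ i → b i ℤ.* a i) ℤ.* sum (λ i → b i ℤ.* a i)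
      ℤ.+ + 2 ℤ.* sum (λ i → b i ℤ.* sum (λ j → B i j ℤ.* a j)) ℤ.+ trace² B
trace²-rankOne a b B = begin
  sum (λ i → sum (λ j → (a i ℤ.* b j ℤ.+ B i j) ℤ.* (a j ℤ.* b i ℤ.+ B j i)))
    ≡⟨ sum-cong-≗ (λ i → trans (sum-cong-≗ λ j → lem (a i) (b j) (B i j) (a j) (b i) (B j i))
         (trans (∑-distrib-+ (λ j → b i ℤ.* a i ℤ.* (b j ℤ.* a j)) (λ j → b j ℤ.* (B j i ℤ.* a i) ℤ.+ b i ℤ.* (B i j ℤ.* a j) ℤ.+ B i j ℤ.* B j i))
         (cong₂ ℤ._+_ (sym (*-distribˡ-sum (b i ℤ.* a i) (λ j → b j ℤ.* a j)))
         (trans (∑-distrib-+ (λ j → b j ℤ.* (B j i ℤ.* a i) ℤ.+ b i ℤ.* (B i j ℤ.* a j)) (λ j → B i j ℤ.* B j i))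
         (cong (λ z → z ℤ.+ square B i i) (trans (∑-distrib-+ (λ j → b j ℤ.* (B j i ℤ.* a i)) (λ j → b i ℤ.* (B i j ℤ.* a j)))
           (cong (ℤ._+_ (sum (λ j → b j ℤ.* (B j i ℤ.* a i)))) (sym (*-distribˡ-sum (b i) (λ j → B i j ℤ.* a j)))))))))) ⟩
  sum (λ i → b i ℤ.* a i ℤ.* s ℤ.+ (f i ℤ.+ g i ℤ.+ square B i i))
    ≡⟨ trans (∑-distrib-+ (λ i → b i ℤ.* a i ℤ.* s) (λ i → f i ℤ.+ g i ℤ.+ square B i i))
        (cong₂ ℤ._+_ (sym (*-distribʳ-sum s (λ i → b i ℤ.* a i)))
          (trans (∑-distrib-+ (λ i → f i ℤ.+ g i) (λ i → square B i i)) (cong (λ z → z ℤ.+ trace² B) (∑-distrib-+ f g)))) ⟩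
  s ℤ.* s ℤ.+ (sum f ℤ.+ sum g ℤ.+ trace² B)
    ≡⟨ cong (λ z → s ℤ.* s ℤ.+ (z ℤ.+ sum g ℤ.+ trace² B))
         (trans (∑-comm (λ i j → b j ℤ.* (B j i ℤ.* a i))) (sum-cong-≗ λ j → sym (*-distribˡ-sum (b j) (λ i → B j i ℤ.* a i)))) ⟩
  s ℤ.* s ℤ.+ (sum g ℤ.+ sum g ℤ.+ trace² B)
    ≡⟨ lem′ (s ℤ.* s) (sum g) (trace² B) ⟩
  s ℤ.* s ℤ.+ + 2 ℤ.* sum g ℤ.+ trace² B ∎
  where
  s = sum (λ i → b i ℤ.* a i)
  f g : _ → ℤ
  f i = sum (λ j → b j ℤ.* (B j i ℤ.* a i))
  g i = b i ℤ.* sum (λ j → B i j ℤ.* a j)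
  lem : ∀ p q r x y z → (p ℤ.* q ℤ.+ r) ℤ.* (x ℤ.* y ℤ.+ z) ≡
    y ℤ.* p ℤ.* (q ℤ.* x) ℤ.+ (q ℤ.* (z ℤ.* p) ℤ.+ y ℤ.* (r ℤ.* x) ℤ.+ r ℤ.* z)
  lem = solve-∀
  lem′ : ∀ a r t → a ℤ.+ (r ℤ.+ r ℤ.+ t) ≡ a ℤ.+ + 2 ℤ.* r ℤ.+ t
  lem′ = solve-∀

-- Newton's identity e₂ = -p₂/2 for p₁ = 0. By `v2` the second coefficient drops by s when a first
-- row and column are added, while the trace of the square grows by 2s.
2*top2≡-trace² : ∀ {n} (A : Fin n → Fin n → ℤ) → Hollow A → + 2 ℤ.* top 2 A ≡ - trace² A
2*top2≡-trace² {zero} A hollow = refl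
2*top2≡-trace² {suc n} A hollow = begin
  + 2 ℤ.* top 2 A
    ≡⟨ cong (ℤ._*_ (+ 2)) (trans (top-suc 2) (cong (λ z → top 2 A′ ℤ.- z)
         (sum-cong-≗ λ j → cong (ℤ._*_ (A zero (suc j))) (v2 (top0≡1 A′ (principal-hollow {A = A} hollow)) j)))) ⟩
  + 2 ℤ.* (top 2 A′ ℤ.- s)
    ≡⟨ lem (top 2 A′) s ⟩
  + 2 ℤ.* top 2 A′ ℤ.- + 2 ℤ.* s
    ≡⟨ cong (λ z → z ℤ.- + 2 ℤ.* s) (2*top2≡-trace² A′ (principal-hollow {A = A} hollow)) ⟩
  - trace² A′ ℤ.- + 2 ℤ.* s
    ≡⟨ lem′ (trace² A′) s ⟩
  - (0ℤ ℤ.+ + 2 ℤ.* s ℤ.+ trace² A′)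
    ≡⟨ cong (λ z → - (z ℤ.* z ℤ.+ + 2 ℤ.* s ℤ.+ trace² A′)) (hollow zero) ⟨
  - (A zero zero ℤ.* A zero zero ℤ.+ + 2 ℤ.* s ℤ.+ trace² A′)
    ≡⟨ cong -_ (trace²-suc A) ⟨
  - trace² A ∎
  where
  open TopRecursion A hollow
  A′ = principal A
  s = sum (λ j → A zero (suc j) ℤ.* A (suc j) zero)
  lem : ∀ t s → + 2 ℤ.* (t ℤ.- s) ≡ + 2 ℤ.* t ℤ.- + 2 ℤ.* s
  lem = solve-∀
  lem′ : ∀ t s → - t ℤ.- + 2 ℤ.* s ≡ - (0ℤ ℤ.+ + 2 ℤ.* s ℤ.+ t)
  lem′ = solve-∀

-- Weighted closed 4-walks are sorted by their visits to vertex 0. A single visit can occur at four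
-- times, each giving w; two visits must be at opposite times since the diagonal vanishes, which
-- happens in two ways, each giving s².
trace²-square-suc : ∀ {n} (A : Fin (suc n) → Fin (suc n) → ℤ) → Hollow A →
  let A′ = principal A
      s = sum (λ j → A zero (suc j) ℤ.* A (suc j) zero)
      w = sum (λ j → A zero (suc j) ℤ.* sum (λ k → A′ j k ℤ.* sum (λ l → A′ k l ℤ.* A (suc l) zero)))
  in trace² (square A) ≡ + 2 ℤ.* (s ℤ.* s) ℤ.+ + 4 ℤ.* w ℤ.+ trace² (square A′)
trace²-square-suc {n} A hollow = begin
  trace² B
    ≡⟨ trace²-suc B ⟩
  B zero zero ℤ.* B zero zero ℤ.+ + 2 ℤ.* sum (λ j → B zero (suc j) ℤ.* B (suc j) zero) ℤ.+ trace² (principal B)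
    ≡⟨ cong₂ (λ x y → x ℤ.* x ℤ.+ + 2 ℤ.* y ℤ.+ trace² (principal B)) B₀₀
         (trans (sum-cong-≗ λ j → cong₂ ℤ._*_ (B₀ j) (B₁ j)) (sum-assoc row A′ col)) ⟩
  s ℤ.* s ℤ.+ + 2 ℤ.* w ℤ.+ trace² (principal B)
    ≡⟨ cong (ℤ._+_ (s ℤ.* s ℤ.+ + 2 ℤ.* w)) (trace²-rankOne (λ i → A (suc i) zero) row (square A′)) ⟩
  s ℤ.* s ℤ.+ + 2 ℤ.* w ℤ.+ (s ℤ.* s ℤ.+ + 2 ℤ.* sum (λ i → row i ℤ.* sum (λ j → square A′ i j ℤ.* A (suc j) zero)) ℤ.+ trace² (square A′))
    ≡⟨ cong (λ z → s ℤ.* s ℤ.+ + 2 ℤ.* w ℤ.+ (s ℤ.* s ℤ.+ + 2 ℤ.* z ℤ.+ trace² (square A′)))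
         (sum-cong-≗ λ i → cong (ℤ._*_ (row i)) (sum-assoc (A′ i) A′ (λ j → A (suc j) zero))) ⟩
  s ℤ.* s ℤ.+ + 2 ℤ.* w ℤ.+ (s ℤ.* s ℤ.+ + 2 ℤ.* w ℤ.+ trace² (square A′))
    ≡⟨ lem (s ℤ.* s) w (trace² (square A′)) ⟩
  + 2 ℤ.* (s ℤ.* s) ℤ.+ + 4 ℤ.* w ℤ.+ trace² (square A′) ∎
  where
  B = square A
  A′ = principal A
  row col : Fin n → ℤ
  row j = A zero (suc j)
  col k = sum (λ l → A′ k l ℤ.* A (suc l) zero)
  s = sum (λ j → A zero (suc j) ℤ.* A (suc j) zero)
  w = sum (λ j → row j ℤ.* sum (λ k → A′ j k ℤ.* col k))
  dropˡ : ∀ (x : ℤ) {a b : ℤ} → a ≡ 0ℤ → a ℤ.* x ℤ.+ b ≡ b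
  dropˡ x {b = b} refl = ℤ.+-identityˡ b
  dropʳ : ∀ (x : ℤ) {a b : ℤ} → a ≡ 0ℤ → x ℤ.* a ℤ.+ b ≡ b
  dropʳ x {b = b} refl = trans (cong (λ z → z ℤ.+ b) (ℤ.*-zeroʳ x)) (ℤ.+-identityˡ b)
  B₀₀ : B zero zero ≡ s
  B₀₀ = dropˡ (A zero zero) (hollow zero)
  B₀ : ∀ j → B zero (suc j) ≡ sum (λ k → row k ℤ.* A′ k j)
  B₀ j = dropˡ (A zero (suc j)) (hollow zero)
  B₁ : ∀ j → B (suc j) zero ≡ col j
  B₁ j = dropʳ (A (suc j) zero) (hollow zero)
  lem : ∀ s w t → s ℤ.+ + 2 ℤ.* w ℤ.+ (s ℤ.+ + 2 ℤ.* w ℤ.+ t) ≡ + 2 ℤ.* s ℤ.+ + 4 ℤ.* w ℤ.+ t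
  lem = solve-∀

-- Newton's identity e₄ = p₂²/8 − p₄/4, valid because the trace p₁ vanishes.
8*top4 : ∀ {n} (A : Fin n → Fin n → ℤ) → Hollow A →
  + 8 ℤ.* top 4 A ≡ trace² A ℤ.* trace² A ℤ.- + 2 ℤ.* trace² (square A)
8*top4 {zero} A hollow = refl
8*top4 {suc n} A hollow = begin
  + 8 ℤ.* top 4 A
    ≡⟨ cong (ℤ._*_ (+ 8)) (trans (top-suc 4) (cong (λ z → top 4 A′ ℤ.- z) v4-sum)) ⟩
  + 8 ℤ.* (top 4 A′ ℤ.- (s ℤ.* top 2 A′ ℤ.+ w))
    ≡⟨ lem (top 4 A′) s (top 2 A′) w ⟩
  + 8 ℤ.* top 4 A′ ℤ.- (+ 4 ℤ.* s ℤ.* (+ 2 ℤ.* top 2 A′) ℤ.+ + 8 ℤ.* w)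
    ≡⟨ cong₂ (λ x y → x ℤ.- (+ 4 ℤ.* s ℤ.* y ℤ.+ + 8 ℤ.* w)) (8*top4 A′ hollow′) (2*top2≡-trace² A′ hollow′) ⟩
  T ℤ.* T ℤ.- + 2 ℤ.* trace² (square A′) ℤ.- (+ 4 ℤ.* s ℤ.* (- T) ℤ.+ + 8 ℤ.* w)
    -- The 4s² in (2s + T)² cancels the contribution of the walks that visit vertex 0 twice.
    ≡⟨ lem′ T s w (trace² (square A′)) ⟩
  (0ℤ ℤ.+ + 2 ℤ.* s ℤ.+ T) ℤ.* (0ℤ ℤ.+ + 2 ℤ.* s ℤ.+ T) ℤ.- + 2 ℤ.* (+ 2 ℤ.* (s ℤ.* s) ℤ.+ + 4 ℤ.* w ℤ.+ trace² (square A′))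
    ≡⟨ cong₂ (λ x y → x ℤ.* x ℤ.- + 2 ℤ.* y) trace²A (trace²-square-suc A hollow) ⟨
  trace² A ℤ.* trace² A ℤ.- + 2 ℤ.* trace² (square A) ∎
  where
  open TopRecursion A hollow
  A′ = principal A
  hollow′ : Hollow A′
  hollow′ = principal-hollow {A = A} hollow
  T = trace² A′
  col : Fin n → ℤ
  col k = sum (λ l → A′ k l ℤ.* A (suc l) zero)
  s = sum (λ j → A zero (suc j) ℤ.* A (suc j) zero)
  w = sum (λ j → A zero (suc j) ℤ.* sum (λ k → A′ j k ℤ.* col k))
  trace²A : trace² A ≡ 0ℤ ℤ.+ + 2 ℤ.* s ℤ.+ T
  trace²A = trans (trace²-suc A) (cong (λ z → z ℤ.* z ℤ.+ + 2 ℤ.* s ℤ.+ T) (hollow zero))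
  v4 : ∀ k → v 4 k ≡ A (suc k) zero ℤ.* top 2 A′ ℤ.+ sum (λ j → A′ k j ℤ.* col j)
  v4 k = trans (v-suc 3 k) (cong (ℤ._+_ (A (suc k) zero ℤ.* top 2 A′))
    (sum-cong-≗ λ j → cong (ℤ._*_ (A′ k j)) (v3 (top0≡1 A′ hollow′) (top1≡0 A′ hollow′) j)))
  distr : ∀ a b t w → a ℤ.* (b ℤ.* t ℤ.+ w) ≡ a ℤ.* b ℤ.* t ℤ.+ a ℤ.* w
  distr = solve-∀
  v4-sum : sum (λ k → A zero (suc k) ℤ.* v 4 k) ≡ s ℤ.* top 2 A′ ℤ.+ w
  v4-sum = trans (sum-cong-≗ λ k → trans (cong (ℤ._*_ (A zero (suc k))) (v4 k))
                   (distr (A zero (suc k)) (A (suc k) zero) (top 2 A′) (sum (λ j → A′ k j ℤ.* col j))))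
    (trans (∑-distrib-+ (λ k → A zero (suc k) ℤ.* A (suc k) zero ℤ.* top 2 A′) (λ k → A zero (suc k) ℤ.* sum (λ j → A′ k j ℤ.* col j)))
      (cong (λ z → z ℤ.+ w) (sym (*-distribʳ-sum (top 2 A′) (λ k → A zero (suc k) ℤ.* A (suc k) zero)))))
  lem : ∀ t s u w → + 8 ℤ.* (t ℤ.- (s ℤ.* u ℤ.+ w)) ≡ + 8 ℤ.* t ℤ.- (+ 4 ℤ.* s ℤ.* (+ 2 ℤ.* u) ℤ.+ + 8 ℤ.* w)
  lem = solve-∀
  lem′ : ∀ T s w q → T ℤ.* T ℤ.- + 2 ℤ.* q ℤ.- (+ 4 ℤ.* s ℤ.* (- T) ℤ.+ + 8 ℤ.* w) ≡
    (0ℤ ℤ.+ + 2 ℤ.* s ℤ.+ T) ℤ.* (0ℤ ℤ.+ + 2 ℤ.* s ℤ.+ T) ℤ.- + 2 ℤ.* (+ 2 ℤ.* (s ℤ.* s) ℤ.+ + 4 ℤ.* w ℤ.+ q)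
  lem′ = solve-∀

-- The coefficient a₄ and closed 4-walks

[_] : Bool → ℕ
[ b ] = if b then 1 else 0

sum-allFin : ∀ {n} (f : Fin n → ℕ) → ListAction.sum (List.map f (allFin n)) ≡ ∑ f
sum-allFin f = trans (cong ListAction.sum (List.map-tabulate (λ i → i) f)) (sum-tabulate f)
  where
  sum-tabulate : ∀ {n} (f : Fin n → ℕ) → ListAction.sum (List.tabulate f) ≡ ∑ f
  sum-tabulate {zero} f = refl
  sum-tabulate {suc n} f = cong (_+_ (f zero)) (sum-tabulate (f ∘ suc))

adjacency : ∀ {n} → Graph n → Fin n → Fin n → ℕ
adjacency G u v = [ adj G u v ]

adjacency-sym : ∀ {n} (G : Graph n) u v → adjacency G u v ≡ adjacency G v u
adjacency-sym G u v = cong [_] (adjSym G u v)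

<ᵇ-true : ∀ {m n} → m < n → (m <ᵇ n) ≡ true
<ᵇ-true {m} {n} m<n with m <ᵇ n | ℕ.<⇒<ᵇ m<n
... | true | _ = refl

<ᵇ-false : ∀ {m n} → n ≤ m → (m <ᵇ n) ≡ false
<ᵇ-false {m} {n} n≤m with m <ᵇ n in eq
... | false = refl
... | true = ⊥-elim (ℕ.<⇒≱ (ℕ.<ᵇ⇒< m n (subst Bool.T (sym eq) _)) n≤m)

degree-sum : ∀ {n} (G : Graph n) → ∑ (λ u → ∑ (adjacency G u)) ≡ 2 * edgeCount G
degree-sum G = begin
  ∑ (λ u → ∑ (adjacency G u))
    ≡⟨ ∑-cong (λ u → trans (∑-cong (oriented u)) (∑-+ (forward u) (λ v → forward v u))) ⟩
  ∑ (λ u → ∑ (forward u) + ∑ (λ v → forward v u))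
    ≡⟨ ∑-+ (λ u → ∑ (forward u)) (λ u → ∑ (λ v → forward v u)) ⟩
  ∑ (λ u → ∑ (forward u)) + ∑ (λ u → ∑ (λ v → forward v u))
    ≡⟨ cong (_+_ (∑ (λ u → ∑ (forward u)))) (∑-swap (λ u v → forward v u)) ⟩
  ∑ (λ u → ∑ (forward u)) + ∑ (λ u → ∑ (forward u))
    ≡⟨ cong (_+_ (∑ (λ u → ∑ (forward u)))) (ℕ.+-identityʳ _) ⟨
  2 * ∑ (λ u → ∑ (forward u))
    ≡⟨ cong (2 *_) (trans (sum-allFin (λ u → ListAction.sum (List.map (forward u) (allFin _)))) (∑-cong λ u → sum-allFin (forward u))) ⟨
  2 * edgeCount G ∎
  where
  forward : _ → _ → ℕ
  forward u v = [ adj G u v ∧ (toℕ u <ᵇ toℕ v) ]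
  oriented : ∀ u v → adjacency G u v ≡ forward u v + forward v u
  oriented u v rewrite adjSym G v u with adj G u v in uv
  ... | false = refl
  ... | true with ℕ.<-cmp (toℕ u) (toℕ v)
  ...   | tri< u<v _ _ rewrite <ᵇ-true u<v | <ᵇ-false (ℕ.<⇒≤ u<v) = refl
  ...   | tri> _ _ v<u rewrite <ᵇ-true v<u | <ᵇ-false (ℕ.<⇒≤ v<u) = refl
  ...   | tri≈ _ u≡v _ with refl ← toℕ-injective u≡v with () ← trans (sym uv) (loopless G u)

codegree : ∀ {n} → Graph n → Fin n → Fin n → ℕ
codegree G u v = ∑ λ w → adjacency G u w * adjacency G w v

closedWalks₄ : ∀ {n} → Graph n → ℕ
closedWalks₄ G = ∑ λ u → ∑ λ v → codegree G u v * codegree G v u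

matrixℤ : ∀ {n} → Graph n → Fin n → Fin n → ℤ
matrixℤ G u v = + adjacency G u v

matrixℤ-hollow : ∀ {n} (G : Graph n) → Hollow (matrixℤ G)
matrixℤ-hollow G u = cong (λ b → + [ b ]) (loopless G u)

charMatrix≡charM : ∀ {n} (G : Graph n) u v → charMatrix G u v ≡ charM (matrixℤ G) u v
charMatrix≡charM G u v with u Fin.≟ v
... | yes refl = cong (if_then 0ℤ ∷ 1ℤ ∷ [] else (- matrixℤ G u u) ∷ []) (sym (δ-refl u))
  where
  δ-refl : ∀ {n} (i : Fin n) → δ i i ≡ true
  δ-refl zero = refl
  δ-refl (suc i) = δ-refl i
... | no u≢v with δ u v in eq
...   | true = ⊥-elim (u≢v (δ-true u v eq))
...   | false = cong (_∷ []) (neg-if (adj G u v))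
  where
  neg-if : ∀ b → (if b then - 1ℤ else 0ℤ) ≡ - (+ [ b ])
  neg-if true = refl
  neg-if false = refl

sum-+ : ∀ {n} (f : Fin n → ℕ) → sum (λ i → + f i) ≡ + ∑ f
sum-+ {zero} f = refl
sum-+ {suc n} f = cong (ℤ._+_ (+ f zero)) (sum-+ (f ∘ suc))

square-+ : ∀ {n} (f : Fin n → Fin n → ℕ) i k → square (λ i j → + f i j) i k ≡ + ∑ (λ j → f i j * f j k)
square-+ f i k = trans (sum-cong-≗ λ j → sym (ℤ.pos-* (f i j) (f j k))) (sum-+ (λ j → f i j * f j k))

trace²-+ : ∀ {n} (f : Fin n → Fin n → ℕ) → trace² (λ i j → + f i j) ≡ + ∑ (λ i → ∑ λ j → f i j * f j i)
trace²-+ f = trans (sum-cong-≗ λ i → square-+ f i i) (sum-+ λ i → ∑ λ j → f i j * f j i)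

trace²-matrixℤ : ∀ {n} (G : Graph n) → trace² (matrixℤ G) ≡ + (2 * edgeCount G)
trace²-matrixℤ G = trans (trace²-+ (adjacency G)) (cong +_ (trans (∑-cong λ u → ∑-cong λ v → idem u v) (degree-sum G)))
  where
  idem : ∀ u v → adjacency G u v * adjacency G v u ≡ adjacency G u v
  idem u v rewrite adjSym G v u with adj G u v
  ... | true = refl
  ... | false = refl

8*a4 : ∀ {n} → 4 ≤ n → (G : Graph n) →
  + 8 ℤ.* a4 G ≡ + (2 * edgeCount G) ℤ.* + (2 * edgeCount G) ℤ.- + 2 ℤ.* + closedWalks₄ G
-- Matching on `4 ≤ n` exposes the order as 4 + n, so that `aCoeff 4` and `shift 4` both reduce to
-- the coefficient of index n.
8*a4 (s≤s (s≤s (s≤s (s≤s (z≤n {n}))))) G = begin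
  + 8 ℤ.* a4 G
    ≡⟨ cong (λ p → + 8 ℤ.* coeff p n) (det-cong (4 + n) (charMatrix≡charM G)) ⟩
  + 8 ℤ.* top 4 (matrixℤ G)
    ≡⟨ 8*top4 (matrixℤ G) (matrixℤ-hollow G) ⟩
  trace² (matrixℤ G) ℤ.* trace² (matrixℤ G) ℤ.- + 2 ℤ.* trace² (square (matrixℤ G))
    ≡⟨ cong₂ (λ x y → x ℤ.* x ℤ.- + 2 ℤ.* y) (trace²-matrixℤ G)
         (trans (trace²-cong (square-+ (adjacency G))) (trace²-+ (codegree G))) ⟩
  + (2 * edgeCount G) ℤ.* + (2 * edgeCount G) ℤ.- + 2 ℤ.* + closedWalks₄ G ∎

a4-≤⇒closedWalks₄-≥ : ∀ {n} → 4 ≤ n → (G H : Graph n) → edgeCount G ≡ edgeCount H →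
  a4 G ℤ.≤ a4 H → closedWalks₄ H ≤ closedWalks₄ G
a4-≤⇒closedWalks₄-≥ 4≤n G H m≡ a≤ = ℤ.drop‿+≤+ (ℤ.*-cancelˡ-≤-pos _ _ (+ 2) 2T≤)
  where
  E : Graph _ → ℤ
  E K = + (2 * edgeCount K) ℤ.* + (2 * edgeCount K)
  8a≤ : E G ℤ.- + 2 ℤ.* + closedWalks₄ G ℤ.≤ E G ℤ.- + 2 ℤ.* + closedWalks₄ H
  8a≤ = subst₂ ℤ._≤_ (8*a4 4≤n G)
    (trans (8*a4 4≤n H) (cong (λ m → + (2 * m) ℤ.* + (2 * m) ℤ.- + 2 ℤ.* + closedWalks₄ H) (sym m≡)))
    (ℤ.*-monoˡ-≤-nonNeg (+ 8) a≤)
  2T≤ : + 2 ℤ.* + closedWalks₄ H ℤ.≤ + 2 ℤ.* + closedWalks₄ G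
  2T≤ = ℤ.neg-cancel-≤ (subst₂ ℤ._≤_ (lem (E G) (+ 2 ℤ.* + closedWalks₄ G)) (lem (E G) (+ 2 ℤ.* + closedWalks₄ H))
    (ℤ.+-monoʳ-≤ (- E G) 8a≤))
    where
    lem : ∀ e z → - e ℤ.+ (e ℤ.- z) ≡ - z
    lem = solve-∀

-- Closed 4-walks and edges of a bipartite graph, counted from one side

module _ {n} (G : Graph n) (side : Fin n → Bool)
    (crossing : ∀ u v → adj G u v ≡ true → side u ≢ side v) where

  private
    a = adjacency G
    c = codegree G
    in-X in-Y : Fin n → ℕ
    in-X u = [ side u ]
    in-Y u = [ not (side u) ]

  crossing-* : ∀ u v → in-Y u * a u v ≡ in-X v * a u v
  crossing-* u v with adj G u v in uv | side u in su | side v in sv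
  ... | false | b | b′ = trans (ℕ.*-zeroʳ [ not b ]) (sym (ℕ.*-zeroʳ [ b′ ]))
  ... | true | true | true = ⊥-elim (crossing u v uv (trans su (sym sv)))
  ... | true | true | false = refl
  ... | true | false | true = refl
  ... | true | false | false = ⊥-elim (crossing u v uv (trans su (sym sv)))

  side-split : ∀ u z → z ≡ in-X u * z + in-Y u * z
  side-split u z with side u
  ... | true = solve₁ z
    where
    solve₁ : ∀ z → z ≡ 1 * z + 0 * z
    solve₁ = solveℕ-∀
  ... | false = sym (ℕ.*-identityˡ z)

  a³-assoc : ∀ u v → ∑ (λ w → c u w * a w v) ≡ ∑ (λ w → a u w * c w v)
  a³-assoc u v = begin
    ∑ (λ w → ∑ (λ s → a u s * a s w) * a w v)
      ≡⟨ ∑-cong (λ w → ∑-*ʳ (a w v) (λ s → a u s * a s w)) ⟩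
    ∑ (λ w → ∑ (λ s → a u s * a s w * a w v))
      ≡⟨ ∑-swap (λ w s → a u s * a s w * a w v) ⟩
    ∑ (λ s → ∑ (λ w → a u s * a s w * a w v))
      ≡⟨ ∑-cong (λ s → trans (∑-cong λ w → ℕ.*-assoc (a u s) (a s w) (a w v)) (sym (∑-*ˡ (a u s) (λ w → a s w * a w v)))) ⟩
    ∑ (λ s → a u s * c s v) ∎

  -- Rotating a closed walk by one step exchanges the two sides.
  walksX≡walksY : ∑ (λ u → ∑ λ v → in-X u * (c u v * c v u)) ≡ ∑ (λ u → ∑ λ v → in-Y u * (c u v * c v u))
  walksX≡walksY = begin
    ∑ (λ u → ∑ λ v → in-X u * (c u v * c v u))
      ≡⟨ ∑-cong (λ u → trans (∑-cong λ v → trans (sym (ℕ.*-assoc (in-X u) (c u v) (c v u)))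
           (trans (cong (_* c v u) (∑-*ˡ (in-X u) (λ w → a u w * a w v)))
                  (∑-*ʳ (c v u) (λ w → in-X u * (a u w * a w v)))))
           (∑-swap (λ v w → in-X u * (a u w * a w v) * c v u))) ⟩
    ∑ (λ u → ∑ λ w → ∑ λ v → in-X u * (a u w * a w v) * c v u)
      ≡⟨ ∑-cong (λ u → ∑-cong λ w → trans (∑-cong λ v → lem (in-X u) (a u w) (a w v) (c v u))
           (sym (∑-*ˡ (in-X u * a u w) (λ v → a w v * c v u)))) ⟩
    ∑ (λ u → ∑ λ w → in-X u * a u w * ∑ λ v → a w v * c v u)
      ≡⟨ ∑-cong (λ u → ∑-cong λ w → cong₂ _*_ (cong (in-X u *_) (adjacency-sym G u w)) (sym (a³-assoc w u))) ⟩
    ∑ (λ u → ∑ λ w → in-X u * a w u * ∑ λ v → c w v * a v u)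
      ≡⟨ ∑-cong (λ u → ∑-cong λ w → trans (cong (_* ∑ (λ v → c w v * a v u)) (sym (crossing-* w u)))
           (∑-*ˡ (in-Y w * a w u) (λ v → c w v * a v u))) ⟩
    ∑ (λ u → ∑ λ w → ∑ λ v → in-Y w * a w u * (c w v * a v u))
      ≡⟨ trans (∑-swap (λ u w → ∑ λ v → in-Y w * a w u * (c w v * a v u)))
           (∑-cong λ w → ∑-swap (λ u v → in-Y w * a w u * (c w v * a v u))) ⟩
    ∑ (λ w → ∑ λ v → ∑ λ u → in-Y w * a w u * (c w v * a v u))
      ≡⟨ ∑-cong (λ w → ∑-cong λ v → trans (∑-cong λ u → lem′ (in-Y w) (a w u) (c w v) (a v u))
           (trans (sym (∑-*ˡ (in-Y w * c w v) (λ u → a v u * a w u)))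
             (trans (cong (in-Y w * c w v *_) (∑-cong λ u → cong (a v u *_) (adjacency-sym G w u)))
               (ℕ.*-assoc (in-Y w) (c w v) (c v w))))) ⟩
    ∑ (λ w → ∑ λ v → in-Y w * (c w v * c v w)) ∎
    where
    lem : ∀ x p q r → x * (p * q) * r ≡ x * p * (q * r)
    lem = solveℕ-∀
    lem′ : ∀ y p q r → y * p * (q * r) ≡ y * q * (r * p)
    lem′ = solveℕ-∀

  closedWalks₄-bipartite : closedWalks₄ G ≡ 2 * ∑ (λ u → ∑ λ v → in-X u * (c u v * c v u))
  closedWalks₄-bipartite = begin
    closedWalks₄ G
      ≡⟨ ∑-cong (λ u → trans (∑-cong λ v → side-split u (c u v * c v u))
           (∑-+ (λ v → in-X u * (c u v * c v u)) (λ v → in-Y u * (c u v * c v u)))) ⟩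
    ∑ (λ u → ∑ (λ v → in-X u * (c u v * c v u)) + ∑ (λ v → in-Y u * (c u v * c v u)))
      ≡⟨ ∑-+ (λ u → ∑ (λ v → in-X u * (c u v * c v u))) (λ u → ∑ (λ v → in-Y u * (c u v * c v u))) ⟩
    W + ∑ (λ u → ∑ (λ v → in-Y u * (c u v * c v u)))
      ≡⟨ cong (_+_ W) (trans (sym walksX≡walksY) (sym (ℕ.+-identityʳ W))) ⟩
    2 * W ∎
    where
    W = ∑ (λ u → ∑ λ v → in-X u * (c u v * c v u))

  edgeCount-bipartite : edgeCount G ≡ ∑ (λ u → in-X u * ∑ (a u))
  edgeCount-bipartite = ℕ.*-cancelˡ-≡ _ _ 2 (begin
    2 * edgeCount G
      ≡⟨ degree-sum G ⟨
    ∑ (λ u → ∑ (a u))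
      ≡⟨ trans (∑-cong λ u → side-split u (∑ (a u))) (∑-+ (λ u → in-X u * ∑ (a u)) (λ u → in-Y u * ∑ (a u))) ⟩
    E + ∑ (λ u → in-Y u * ∑ (a u))
      ≡⟨ cong (_+_ E) (trans (∑-cong λ u → ∑-*ˡ (in-Y u) (a u)) (trans (∑-cong λ u → ∑-cong λ v → crossing-* u v)
          (trans (∑-swap (λ u v → in-X v * a u v)) (trans (∑-cong λ v → ∑-cong λ u → cong (in-X v *_) (adjacency-sym G u v))
            (trans (∑-cong λ v → sym (∑-*ˡ (in-X v) (a v))) (sym (ℕ.+-identityʳ E))))))) ⟩
    2 * E ∎)
    where
    E = ∑ (λ u → in-X u * ∑ (a u))

  codegree-crossing : ∀ u v → side u ≢ side v → c u v ≡ 0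
  codegree-crossing u v su≢sv = trans (∑-cong λ w → no-path w (side w) refl) (∑-0 n)
    where
    ∑-0 : ∀ n → ∑ {n} (λ _ → 0) ≡ 0
    ∑-0 zero = refl
    ∑-0 (suc n) = ∑-0 n
    third : ∀ p q r → p ≢ q → p ≢ r → q ≢ r → ∀ {A : Set} → A
    third true true _ h _ _ = ⊥-elim (h refl)
    third false false _ h _ _ = ⊥-elim (h refl)
    third true false true _ h _ = ⊥-elim (h refl)
    third true false false _ _ h = ⊥-elim (h refl)
    third false true true _ _ h = ⊥-elim (h refl)
    third false true false _ h _ = ⊥-elim (h refl)
    no-path : ∀ w b → side w ≡ b → a u w * a w v ≡ 0
    no-path w b _ with adj G u w in uw | adj G w v in wv
    ... | false | _ = refl
    ... | true | false = refl
    ... | true | true = third (side u) (side w) (side v) (crossing u w uw) su≢sv (crossing w v wv)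

  codegree-refl : ∀ u → c u u ≡ ∑ (a u)
  codegree-refl u = ∑-cong idem
    where
    idem : ∀ w → a u w * a w u ≡ a u w
    idem w rewrite adjSym G w u with adj G u w
    ... | true = refl
    ... | false = refl

-- Nested neighbourhoods

sq : ℕ → ℕ
sq z = z * z

Σ₁-cong : ∀ K {f g : ℕ → ℕ} → (∀ i → i < K → f (suc i) ≡ g (suc i)) → Σ₁ K f ≡ Σ₁ K g
Σ₁-cong zero h = refl
Σ₁-cong (suc K) h = cong₂ _+_ (Σ₁-cong K λ i i<K → h i (ℕ.m<n⇒m<1+n i<K)) (h K (ℕ.n<1+n K))

Σ₁-0 : ∀ K → Σ₁ K (λ _ → 0) ≡ 0
Σ₁-0 zero = refl
Σ₁-0 (suc K) = trans (ℕ.+-identityʳ _) (Σ₁-0 K)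

Σ₁-∑ : ∀ K {n} (f : Fin n → ℕ → ℕ) → Σ₁ K (λ i → ∑ (λ v → f v i)) ≡ ∑ (λ v → Σ₁ K (f v))
Σ₁-∑ zero {zero} f = refl
Σ₁-∑ zero {suc n} f = Σ₁-∑ zero {n} (f ∘ suc)
Σ₁-∑ (suc K) f = trans (cong (λ z → z + ∑ (λ v → f v (suc K))) (Σ₁-∑ K f))
  (sym (∑-+ (λ v → Σ₁ K (f v)) (λ v → f v (suc K))))

Σ₁-pick : ∀ K j (g : ℕ → ℕ) → Σ₁ K (λ i → [ ⌊ suc j ℕ.≟ i ⌋ ] * g i) ≡ [ j <ᵇ K ] * g (suc j)
Σ₁-pick zero j g = refl
Σ₁-pick (suc K) j g = trans (cong (λ z → z + [ ⌊ suc j ℕ.≟ suc K ⌋ ] * g (suc K)) (Σ₁-pick K j g)) last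
  where
  ≢-case : j ≢ K → [ ⌊ suc j ℕ.≟ suc K ⌋ ] ≡ 0
  ≢-case h = cong [_] (trans (isYes≗does (suc j ℕ.≟ suc K)) (dec-false (suc j ℕ.≟ suc K) (h ∘ ℕ.suc-injective)))
  last : [ j <ᵇ K ] * g (suc j) + [ ⌊ suc j ℕ.≟ suc K ⌋ ] * g (suc K) ≡ [ j <ᵇ suc K ] * g (suc j)
  last with ℕ.<-cmp j K
  ... | tri< j<K j≢K _ rewrite ≢-case j≢K | <ᵇ-true j<K | <ᵇ-true (ℕ.m<n⇒m<1+n j<K) = ℕ.+-identityʳ _
  ... | tri> _ j≢K K<j rewrite ≢-case j≢K | <ᵇ-false (ℕ.<⇒≤ K<j) | <ᵇ-false K<j = refl
  ... | tri≈ _ refl _ rewrite <ᵇ-false (ℕ.≤-refl {K}) | <ᵇ-true (ℕ.n<1+n K)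
        | isYes≗does (suc K ℕ.≟ suc K) | dec-true (suc K ℕ.≟ suc K) refl = refl

-- A shape has w i rows of length ℓ i, for 1 ≤ i ≤ K.
Φ : ℕ → (w ℓ : ℕ → ℕ) → ℕ → ℕ
Φ K w ℓ a = Σ₁ K (λ j → w j * sq (a ⊓ ℓ j))
Ψ : ℕ → (w ℓ : ℕ → ℕ) → ℕ
Ψ K w ℓ = Σ₁ K (λ i → w i * Φ K w ℓ (ℓ i))

-- `classes` states the sizes of the classes as a change of variables for an arbitrary weight g,
-- which is how they enter every sum. `nested` also covers u = v, where it gives the degree. The
-- lengths ℓ need not be sorted, so new rows can be placed in front.
record Ferrers {n} (G : Graph n) (K : ℕ) (w ℓ : ℕ → ℕ) : Set where
  field
    side     : Fin n → Bool
    crossing : ∀ u v → adj G u v ≡ true → side u ≢ side v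
    class    : Fin n → ℕ
    classes  : ∀ g → ∑ (λ v → [ side v ] * g (class v)) ≡ Σ₁ K (λ i → w i * g i)
    nested   : ∀ u v → side u ≡ true → side v ≡ true → codegree G u v ≡ ℓ (class u) ⊓ ℓ (class v)

  edgeCount-Ferrers : edgeCount G ≡ Σ₁ K (λ i → w i * ℓ i)
  edgeCount-Ferrers = begin
    edgeCount G                                 ≡⟨ edgeCount-bipartite G side crossing ⟩
    ∑ (λ u → [ side u ] * ∑ (adjacency G u))    ≡⟨ ∑-cong (λ u → row u (side u) refl) ⟩
    ∑ (λ u → [ side u ] * ℓ (class u))          ≡⟨ classes ℓ ⟩
    Σ₁ K (λ i → w i * ℓ i)                      ∎
    where
    row : ∀ u b → side u ≡ b → [ b ] * ∑ (adjacency G u) ≡ [ b ] * ℓ (class u)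
    row u false su = refl
    row u true su = cong (_+ 0) (trans (sym (codegree-refl G side crossing u))
      (trans (nested u u su su) (ℕ.⊓-idem (ℓ (class u)))))

  closedWalks₄-Ferrers : closedWalks₄ G ≡ 2 * Ψ K w ℓ
  closedWalks₄-Ferrers = trans (closedWalks₄-bipartite G side crossing) (cong (2 *_) (begin
    ∑ (λ u → ∑ λ v → [ side u ] * (codegree G u v * codegree G v u))
      ≡⟨ ∑-cong (λ u → trans (∑-cong λ v → pair u v (side u) (side v) refl refl)
           (sym (∑-*ˡ [ side u ] λ v → [ side v ] * sq (ℓ (class u) ⊓ ℓ (class v))))) ⟩
    ∑ (λ u → [ side u ] * ∑ λ v → [ side v ] * sq (ℓ (class u) ⊓ ℓ (class v)))
      ≡⟨ ∑-cong (λ u → cong ([ side u ] *_) (classes λ j → sq (ℓ (class u) ⊓ ℓ j))) ⟩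
    ∑ (λ u → [ side u ] * Φ K w ℓ (ℓ (class u)))
      ≡⟨ classes (λ i → Φ K w ℓ (ℓ i)) ⟩
    Ψ K w ℓ ∎))
    where
    pair : ∀ u v b b′ → side u ≡ b → side v ≡ b′ →
      [ b ] * (codegree G u v * codegree G v u) ≡ [ b ] * ([ b′ ] * sq (ℓ (class u) ⊓ ℓ (class v)))
    pair u v false b′ su sv = refl
    pair u v true true su sv = cong (_+ 0) (trans
      (cong₂ _*_ (nested u v su sv) (trans (nested v u sv su) (ℕ.⊓-comm (ℓ (class v)) (ℓ (class u)))))
      (sym (ℕ.+-identityʳ _)))
    pair u v true false su sv = cong (_+ 0) (cong (_* codegree G v u)
      (codegree-crossing G side crossing u v λ eq → case-absurd (trans (sym su) (trans eq sv))))
      where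
      case-absurd : true ≢ false
      case-absurd ()

<ᵇ-∸ : ∀ i j k → (i + j <ᵇ k) ≡ (j <ᵇ k ∸ i)
<ᵇ-∸ zero j k = refl
<ᵇ-∸ (suc i) j zero = refl
<ᵇ-∸ (suc i) j (suc k) = <ᵇ-∸ i j k

<ᵇ-⊓ : ∀ j a b → [ j <ᵇ a ] * [ j <ᵇ b ] ≡ [ j <ᵇ a ⊓ b ]
<ᵇ-⊓ j zero b = refl
<ᵇ-⊓ j (suc a) zero = ℕ.*-zeroʳ [ j <ᵇ suc a ]
<ᵇ-⊓ zero (suc a) (suc b) = refl
<ᵇ-⊓ (suc j) (suc a) (suc b) = <ᵇ-⊓ j a b

Σ₁-mono-≤ : ∀ (f : ℕ → ℕ) {m n} → m ≤ n → Σ₁ m f ≤ Σ₁ n f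
Σ₁-mono-≤ f {m} {zero} z≤n = z≤n
Σ₁-mono-≤ f {m} {suc n} m≤1+n with ℕ.m≤n⇒m<n∨m≡n m≤1+n
... | inj₁ (s≤s m≤n) = ℕ.≤-trans (Σ₁-mono-≤ f m≤n) (ℕ.m≤m+n (Σ₁ n f) (f (suc n)))
... | inj₂ refl = ℕ.≤-refl

∑-≥-term : ∀ {n} (f : Fin n → ℕ) v → f v ≤ ∑ f
∑-≥-term f zero = ℕ.m≤m+n (f zero) _
∑-≥-term f (suc v) = ℕ.≤-trans (∑-≥-term (f ∘ suc) v) (ℕ.m≤n+m _ (f zero))

∑-const : ∀ n c → ∑ {n} (λ _ → c) ≡ n * c
∑-const zero c = refl
∑-const (suc n) c = cong (_+_ c) (∑-const n c)

-- Difference graphs: transposition, class sizes and row lengths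

swapSides : ∀ {n k} {G : Graph n} → DifferenceGraph G k → DifferenceGraph G k
swapSides {k = k} D = record
  { part      = Sum.swap ∘ part D
  ; nonemptyX = λ i → let v , eq = nonemptyY D i in v , cong Sum.swap eq
  ; nonemptyY = λ j → let v , eq = nonemptyX D j in v , cong Sum.swap eq
  ; adjRule   = λ u v → trans (adjRule D u v) (diffAdj-swap (part D u) (part D v))
  }
  where
  diffAdj-swap : ∀ p q → diffAdj k p q ≡ diffAdj k (Sum.swap p) (Sum.swap q)
  diffAdj-swap (inj₁ i) (inj₁ j) = refl
  diffAdj-swap (inj₁ i) (inj₂ j) = cong (_<ᵇ k) (ℕ.+-comm (toℕ i) (toℕ j))
  diffAdj-swap (inj₂ i) (inj₁ j) = cong (_<ᵇ k) (ℕ.+-comm (toℕ j) (toℕ i))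
  diffAdj-swap (inj₂ i) (inj₂ j) = refl

module _ {n k} {G : Graph n} (D : DifferenceGraph G k) where

  x-∑ : ∀ i → x D i ≡ ∑ (λ v → [ inX i (part D v) ])
  x-∑ i = sum-allFin (λ v → [ inX i (part D v) ])

  y-∑ : ∀ i → y D i ≡ ∑ (λ v → [ inY i (part D v) ])
  y-∑ i = sum-allFin (λ v → [ inY i (part D v) ])

  y-swapSides : ∀ i → y (swapSides D) i ≡ x D i
  y-swapSides i = trans (sum-allFin (λ v → [ inY i (Sum.swap (part D v)) ]))
    (trans (∑-cong λ v → cong [_] (inY-swap (part D v))) (sym (x-∑ i)))
    where
    inY-swap : (p : Fin k ⊎ Fin k) → inY i (Sum.swap p) ≡ inX i p
    inY-swap (inj₁ j) = refl
    inY-swap (inj₂ j) = refl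

  x-swapSides : ∀ i → x (swapSides D) i ≡ y D i
  x-swapSides i = trans (sum-allFin (λ v → [ inX i (Sum.swap (part D v)) ]))
    (trans (∑-cong λ v → cong [_] (inX-swap (part D v))) (sym (y-∑ i)))
    where
    inX-swap : (p : Fin k ⊎ Fin k) → inX i (Sum.swap p) ≡ inY i p
    inX-swap (inj₁ j) = refl
    inX-swap (inj₂ j) = refl

  x-positive : ∀ i → i < k → 1 ≤ x D (suc i)
  x-positive i i<k with v , eq ← nonemptyX D (fromℕ< i<k) = 1≤x
    where
    in-X : inX (suc i) (part D v) ≡ true
    in-X rewrite eq = trans (isYes≗does (suc (toℕ (fromℕ< i<k)) ℕ.≟ suc i))
      (dec-true (suc (toℕ (fromℕ< i<k)) ℕ.≟ suc i) (cong suc (toℕ-fromℕ< i<k)))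
    1≤x : 1 ≤ x D (suc i)
    1≤x = subst₂ _≤_ (cong [_] in-X) (sym (x-∑ (suc i))) (∑-≥-term (λ v → [ inX (suc i) (part D v) ]) v)

  isX : Fin k ⊎ Fin k → Bool
  isX (inj₁ _) = true
  isX (inj₂ _) = false

  position : Fin k ⊎ Fin k → ℕ
  position (inj₁ i) = suc (toℕ i)
  position (inj₂ j) = suc (toℕ j)

  isYupTo : ℕ → Fin k ⊎ Fin k → Bool
  isYupTo c (inj₁ _) = false
  isYupTo c (inj₂ j) = toℕ j <ᵇ c

  x-classes : ∀ g → ∑ (λ v → [ isX (part D v) ] * g (position (part D v))) ≡ Σ₁ k (λ i → x D i * g i)
  x-classes g = begin
    ∑ (λ v → [ isX (part D v) ] * g (position (part D v)))
      ≡⟨ ∑-cong (λ v → pick (part D v)) ⟨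
    ∑ (λ v → Σ₁ k (λ i → [ inX i (part D v) ] * g i))
      ≡⟨ Σ₁-∑ k (λ v i → [ inX i (part D v) ] * g i) ⟨
    Σ₁ k (λ i → ∑ (λ v → [ inX i (part D v) ] * g i))
      ≡⟨ Σ₁-cong k (λ i _ → trans (sym (∑-*ʳ (g (suc i)) (λ v → [ inX (suc i) (part D v) ]))) (cong (_* g (suc i)) (sym (x-∑ (suc i))))) ⟩
    Σ₁ k (λ i → x D i * g i) ∎
    where
    pick : ∀ p → Σ₁ k (λ i → [ inX i p ] * g i) ≡ [ isX p ] * g (position p)
    pick (inj₁ j) = trans (Σ₁-pick k (toℕ j) g) (cong (λ b → [ b ] * g (suc (toℕ j))) (<ᵇ-true (toℕ<n j)))
    pick (inj₂ j) = Σ₁-0 k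

  y-count : ∀ c → Σ₁ c (y D) ≡ ∑ (λ v → [ isYupTo c (part D v) ])
  y-count c = begin
    Σ₁ c (y D)
      ≡⟨ Σ₁-cong c (λ i _ → y-∑ (suc i)) ⟩
    Σ₁ c (λ i → ∑ (λ v → [ inY i (part D v) ]))
      ≡⟨ Σ₁-∑ c (λ v i → [ inY i (part D v) ]) ⟩
    ∑ (λ v → Σ₁ c (λ i → [ inY i (part D v) ]))
      ≡⟨ ∑-cong (λ v → pick (part D v)) ⟩
    ∑ (λ v → [ isYupTo c (part D v) ]) ∎
    where
    pick : ∀ p → Σ₁ c (λ i → [ inY i p ]) ≡ [ isYupTo c p ]
    pick (inj₁ j) = Σ₁-0 c
    pick (inj₂ j) = trans (Σ₁-cong c λ i _ → sym (ℕ.*-identityʳ [ ⌊ suc (toℕ j) ℕ.≟ suc i ⌋ ]))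
      (trans (Σ₁-pick c (toℕ j) (λ _ → 1)) (ℕ.*-identityʳ [ toℕ j <ᵇ c ]))

  order≡ : n ≡ Σ₁ k (x D) + Σ₁ k (y D)
  order≡ = begin
    n
      ≡⟨ trans (∑-const n 1) (ℕ.*-identityʳ n) ⟨
    ∑ {n} (λ _ → 1)
      ≡⟨ ∑-cong (λ v → split (part D v)) ⟩
    ∑ (λ v → [ isX (part D v) ] * 1 + [ isYupTo k (part D v) ])
      ≡⟨ ∑-+ (λ v → [ isX (part D v) ] * 1) (λ v → [ isYupTo k (part D v) ]) ⟩
    ∑ (λ v → [ isX (part D v) ] * 1) + ∑ (λ v → [ isYupTo k (part D v) ])
      ≡⟨ cong₂ _+_ (trans (x-classes (λ _ → 1)) (Σ₁-cong k λ i _ → ℕ.*-identityʳ (x D (suc i)))) (sym (y-count k)) ⟩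
    Σ₁ k (x D) + Σ₁ k (y D) ∎
    where
    split : ∀ p → 1 ≡ [ isX p ] * 1 + [ isYupTo k p ]
    split (inj₁ i) = refl
    split (inj₂ j) = cong [_] (sym (<ᵇ-true (toℕ<n j)))

  rowLength : ℕ → ℕ
  rowLength i = Σ₁ (suc k ∸ i) (y D)

  differenceGraph-Ferrers : Ferrers G k (x D) rowLength
  differenceGraph-Ferrers = record
    { side     = isX ∘ part D
    ; crossing = λ u v uv → sides-differ (part D u) (part D v) (trans (sym (adjRule D u v)) uv)
    ; class    = position ∘ part D
    ; classes  = x-classes
    ; nested   = nested
    }
    where
    sides-differ : ∀ p q → diffAdj k p q ≡ true → isX p ≢ isX q
    sides-differ (inj₁ _) (inj₂ _) _ ()
    sides-differ (inj₂ _) (inj₁ _) _ ()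
    common : ∀ p q r → isX p ≡ true → isX q ≡ true →
      [ diffAdj k p r ] * [ diffAdj k r q ] ≡ [ isYupTo ((suc k ∸ position p) ⊓ (suc k ∸ position q)) r ]
    common (inj₁ i) (inj₁ i′) (inj₁ j) _ _ = refl
    common (inj₁ i) (inj₁ i′) (inj₂ j) _ _ = trans
      (cong₂ (λ b b′ → [ b ] * [ b′ ]) (<ᵇ-∸ (toℕ i) (toℕ j) k) (<ᵇ-∸ (toℕ i′) (toℕ j) k))
      (<ᵇ-⊓ (toℕ j) (k ∸ toℕ i) (k ∸ toℕ i′))
    nested : ∀ u v → isX (part D u) ≡ true → isX (part D v) ≡ true →
      codegree G u v ≡ rowLength (position (part D u)) ⊓ rowLength (position (part D v))
    nested u v su sv = begin
      codegree G u v
        ≡⟨ ∑-cong (λ w → trans (cong₂ (λ b b′ → [ b ] * [ b′ ]) (adjRule D u w) (adjRule D w v))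
             (common (part D u) (part D v) (part D w) su sv)) ⟩
      ∑ (λ w → [ isYupTo (a ⊓ b) (part D w) ])
        ≡⟨ y-count (a ⊓ b) ⟨
      Σ₁ (a ⊓ b) (y D)
        -- Common neighbours form the shorter of two initial segments of the Y-classes; partial sums
        -- are monotone and hence commute with the minimum.
        ≡⟨ ℕ.mono-≤-distrib-⊓ {f = λ c → Σ₁ c (y D)} (Σ₁-mono-≤ (y D)) a b ⟩
      Σ₁ a (y D) ⊓ Σ₁ b (y D) ∎
      where
      a = suc k ∸ position (part D u)
      b = suc k ∸ position (part D v)

-- Realising a shape as a connected bipartite graph

∑-splitAt : ∀ m {n} (f : Fin (m + n) → ℕ) → ∑ f ≡ ∑ (λ i → f (i ↑ˡ n)) + ∑ (λ j → f (m ↑ʳ j))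
∑-splitAt zero f = refl
∑-splitAt (suc m) f = trans (cong (_+_ (f zero)) (∑-splitAt m (f ∘ suc))) (sym (ℕ.+-assoc (f zero) _ _))

∑-<ᵇ : ∀ n a → ∑ {n} (λ c → [ toℕ c <ᵇ a ]) ≡ a ⊓ n
∑-<ᵇ zero a = sym (ℕ.⊓-zeroʳ a)
∑-<ᵇ (suc n) zero = trans (∑-const (suc n) 0) (ℕ.*-zeroʳ n)
∑-<ᵇ (suc n) (suc a) = cong suc (∑-<ᵇ n a)

blockOf : ∀ K w → Fin (Σ₁ K w) → ℕ
blockOf (suc K) w r = [ blockOf K w , (λ _ → suc K) ]′ (splitAt (Σ₁ K w) r)

∑-blockOf : ∀ K w (g : ℕ → ℕ) → ∑ (λ r → g (blockOf K w r)) ≡ Σ₁ K (λ i → w i * g i)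
∑-blockOf zero w g = refl
∑-blockOf (suc K) w g = begin
  ∑ (λ r → g (blockOf (suc K) w r))
    ≡⟨ ∑-splitAt (Σ₁ K w) (λ r → g (blockOf (suc K) w r)) ⟩
  ∑ (λ r → g (blockOf (suc K) w (r ↑ˡ w (suc K)))) + ∑ (λ r → g (blockOf (suc K) w (Σ₁ K w ↑ʳ r)))
    ≡⟨ cong₂ _+_
         (∑-cong λ r → cong (g ∘ [ blockOf K w , (λ _ → suc K) ]′) (splitAt-↑ˡ (Σ₁ K w) r (w (suc K))))
         (∑-cong λ r → cong (g ∘ [ blockOf K w , (λ _ → suc K) ]′) (splitAt-↑ʳ (Σ₁ K w) (w (suc K)) r)) ⟩
  ∑ (λ r → g (blockOf K w r)) + ∑ {w (suc K)} (λ _ → g (suc K))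
    ≡⟨ cong₂ _+_ (∑-blockOf K w g) (∑-const (w (suc K)) (g (suc K))) ⟩
  Σ₁ (suc K) (λ i → w i * g i) ∎

blockOf-range : ∀ K w (P : ℕ → Set) → (∀ i → i < K → P (suc i)) → ∀ r → P (blockOf K w r)
blockOf-range (suc K) w P h r with splitAt (Σ₁ K w) r
... | inj₁ r′ = blockOf-range K w P (λ i i<K → h i (ℕ.m<n⇒m<1+n i<K)) r′
... | inj₂ _ = h K (ℕ.n<1+n K)

blockOf-surjective : ∀ K w i → i < K → 1 ≤ w (suc i) → ∃ λ r → blockOf K w r ≡ suc i
blockOf-surjective (suc K) w i (s≤s i≤K) 1≤w with ℕ.m≤n⇒m<n∨m≡n i≤K
... | inj₁ i<K = let r , eq = blockOf-surjective K w i i<K 1≤w in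
  r ↑ˡ w (suc K) , trans (cong [ blockOf K w , (λ _ → suc K) ]′ (splitAt-↑ˡ (Σ₁ K w) r (w (suc K)))) eq
... | inj₂ refl = Σ₁ K w ↑ʳ fromℕ< 1≤w ,
  cong [ blockOf K w , (λ _ → suc K) ]′ (splitAt-↑ʳ (Σ₁ K w) (w (suc K)) (fromℕ< 1≤w))

infixr 5 _++ʷ_
_++ʷ_ : ∀ {n} {G : Graph n} {u v w} → Walk G u v → Walk G v w → Walk G u w
here ++ʷ q = q
step e p ++ʷ q = step e (p ++ʷ q)

reverse : ∀ {n} {G : Graph n} {u v} → Walk G u v → Walk G v u
reverse here = here
reverse {G = G} (step {u} {w} e p) = reverse p ++ʷ step (trans (adjSym G w u) e) here

module Realisation (K : ℕ) (w ℓ : ℕ → ℕ) (q : ℕ)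
    (bounds : ∀ i → i < K → 1 ≤ ℓ (suc i) × ℓ (suc i) ≤ suc q) where

  Label : Set
  Label = ℕ ⊎ Fin (suc q)

  label : Fin (Σ₁ K w + suc q) → Label
  label v = Sum.map₁ (blockOf K w) (splitAt (Σ₁ K w) v)

  adjLabel : Label → Label → Bool
  adjLabel (inj₁ i) (inj₂ c) = toℕ c <ᵇ ℓ i
  adjLabel (inj₂ c) (inj₁ i) = toℕ c <ᵇ ℓ i
  adjLabel (inj₁ _) (inj₁ _) = false
  adjLabel (inj₂ _) (inj₂ _) = false

  adjLabel-sym : ∀ a b → adjLabel a b ≡ adjLabel b a
  adjLabel-sym (inj₁ _) (inj₁ _) = refl
  adjLabel-sym (inj₁ _) (inj₂ _) = refl
  adjLabel-sym (inj₂ _) (inj₁ _) = refl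
  adjLabel-sym (inj₂ _) (inj₂ _) = refl

  adjLabel-loopless : ∀ a → adjLabel a a ≡ false
  adjLabel-loopless (inj₁ _) = refl
  adjLabel-loopless (inj₂ _) = refl

  graph : Graph (Σ₁ K w + suc q)
  graph = record
    { adj      = λ u v → adjLabel (label u) (label v)
    ; adjSym   = λ u v → adjLabel-sym (label u) (label v)
    ; loopless = λ u → adjLabel-loopless (label u)
    }

  isRow : Label → Bool
  isRow (inj₁ _) = true
  isRow (inj₂ _) = false

  rowClass : Label → ℕ
  rowClass (inj₁ i) = i
  -- A default value: columns have weight 0 in `classes`.
  rowClass (inj₂ _) = 0

  Bounded : Label → Set
  Bounded (inj₁ i) = 1 ≤ ℓ i × ℓ i ≤ suc q
  Bounded (inj₂ _) = ⊤

  label-bounded : ∀ v → Bounded (label v)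
  label-bounded v with splitAt (Σ₁ K w) v
  ... | inj₁ r = blockOf-range K w (λ i → 1 ≤ ℓ i × ℓ i ≤ suc q) bounds r
  ... | inj₂ c = tt

  ∑-label : ∀ (f : Label → ℕ) → ∑ (f ∘ label) ≡ ∑ (λ r → f (inj₁ (blockOf K w r))) + ∑ (λ c → f (inj₂ c))
  ∑-label f = trans (∑-splitAt (Σ₁ K w) (f ∘ label)) (cong₂ _+_
    (∑-cong λ r → cong (f ∘ Sum.map₁ (blockOf K w)) (splitAt-↑ˡ (Σ₁ K w) r (suc q)))
    (∑-cong λ c → cong (f ∘ Sum.map₁ (blockOf K w)) (splitAt-↑ʳ (Σ₁ K w) (suc q) c)))

  sides-differ : ∀ a b → adjLabel a b ≡ true → isRow a ≢ isRow b
  sides-differ (inj₁ _) (inj₂ _) _ ()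
  sides-differ (inj₂ _) (inj₁ _) _ ()

  ferrers : Ferrers graph K w ℓ
  ferrers = record
    { side     = isRow ∘ label
    ; crossing = λ u v → sides-differ (label u) (label v)
    ; class    = rowClass ∘ label
    ; classes  = classes
    ; nested   = λ u v → nested (label u) (label v) (label-bounded u)
    }
    where
    classes : ∀ g → ∑ (λ v → [ isRow (label v) ] * g (rowClass (label v))) ≡ Σ₁ K (λ i → w i * g i)
    classes g = begin
      ∑ (λ v → [ isRow (label v) ] * g (rowClass (label v)))
        ≡⟨ ∑-label (λ a → [ isRow a ] * g (rowClass a)) ⟩
      ∑ (λ r → 1 * g (blockOf K w r)) + ∑ {suc q} (λ _ → 0)
        ≡⟨ cong₂ _+_ (∑-cong λ r → ℕ.*-identityˡ (g (blockOf K w r))) (trans (∑-const (suc q) 0) (ℕ.*-zeroʳ (suc q))) ⟩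
      ∑ (λ r → g (blockOf K w r)) + 0
        ≡⟨ trans (ℕ.+-identityʳ _) (∑-blockOf K w g) ⟩
      Σ₁ K (λ i → w i * g i) ∎
    nested : ∀ a b → Bounded a → isRow a ≡ true → isRow b ≡ true →
      ∑ (λ v → [ adjLabel a (label v) ] * [ adjLabel (label v) b ]) ≡ ℓ (rowClass a) ⊓ ℓ (rowClass b)
    nested (inj₁ i) (inj₁ j) (_ , ℓi≤) _ _ = begin
      ∑ (λ v → [ adjLabel (inj₁ i) (label v) ] * [ adjLabel (label v) (inj₁ j) ])
        ≡⟨ ∑-label (λ a → [ adjLabel (inj₁ i) a ] * [ adjLabel a (inj₁ j) ]) ⟩
      ∑ {Σ₁ K w} (λ _ → 0) + ∑ {suc q} (λ c → [ toℕ c <ᵇ ℓ i ] * [ toℕ c <ᵇ ℓ j ])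
        ≡⟨ cong₂ _+_ (trans (∑-const (Σ₁ K w) 0) (ℕ.*-zeroʳ (Σ₁ K w)))
             (∑-cong {suc q} λ c → <ᵇ-⊓ (toℕ c) (ℓ i) (ℓ j)) ⟩
      ∑ {suc q} (λ c → [ toℕ c <ᵇ ℓ i ⊓ ℓ j ])
        ≡⟨ ∑-<ᵇ (suc q) (ℓ i ⊓ ℓ j) ⟩
      ℓ i ⊓ ℓ j ⊓ suc q
        ≡⟨ ℕ.m≤n⇒m⊓n≡m (ℕ.≤-trans (ℕ.m⊓n≤m (ℓ i) (ℓ j)) ℓi≤) ⟩
      ℓ i ⊓ ℓ j ∎

  bipartite : Bipartite graph
  bipartite = isRow ∘ label , λ u v → sides-differ (label u) (label v)

  -- Column 0 is a hub: every row has length at least 1 and so meets it, and every column reaches it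
  -- through a row of full length.
  connected : ∀ i → i < K → 1 ≤ w (suc i) → ℓ (suc i) ≡ suc q → Connected graph
  connected i i<K 1≤w full u v = toHub u ++ʷ reverse (toHub v)
    where
    r = proj₁ (blockOf-surjective K w i i<K 1≤w)
    fullRow hub : Fin (Σ₁ K w + suc q)
    fullRow = r ↑ˡ suc q
    hub = Σ₁ K w ↑ʳ zero
    label-fullRow : label fullRow ≡ inj₁ (suc i)
    label-fullRow = trans (cong (Sum.map₁ (blockOf K w)) (splitAt-↑ˡ (Σ₁ K w) r (suc q)))
      (cong inj₁ (proj₂ (blockOf-surjective K w i i<K 1≤w)))
    label-hub : label hub ≡ inj₂ zero
    label-hub = cong (Sum.map₁ (blockOf K w)) (splitAt-↑ʳ (Σ₁ K w) (suc q) zero)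
    row-hub : ∀ a → isRow a ≡ true → Bounded a → adjLabel a (label hub) ≡ true
    row-hub (inj₁ j) _ (1≤ℓ , _) rewrite label-hub = <ᵇ-true 1≤ℓ
    column-fullRow : ∀ a → isRow a ≡ false → adjLabel a (label fullRow) ≡ true
    column-fullRow (inj₂ c) _ rewrite label-fullRow | full = <ᵇ-true (toℕ<n c)
    toHub : ∀ u → Walk graph u hub
    toHub u with isRow (label u) in eq
    ... | true = step (row-hub (label u) eq (label-bounded u)) here
    ... | false = step (column-fullRow (label u) eq)
      (step (row-hub (label fullRow) (cong isRow label-fullRow) (label-bounded fullRow)) here)

realise : ∀ {n} K w ℓ q → n ≡ Σ₁ K w + suc q → (∀ i → i < K → 1 ≤ ℓ (suc i) × ℓ (suc i) ≤ suc q) →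
  ∀ i → i < K → 1 ≤ w (suc i) → ℓ (suc i) ≡ suc q →
  ∃ λ (H : Graph n) → InB n (Σ₁ K (λ i → w i * ℓ i)) H × Ferrers H K w ℓ
realise K w ℓ q refl bounds i i<K 1≤w full =
  graph , (connected i i<K 1≤w full , bipartite , Ferrers.edgeCount-Ferrers ferrers) , ferrers
  where open Realisation K w ℓ q bounds

-- Minimising a₄ with n and m fixed means maximising Ψ among Ferrers shapes with n and m fixed.
optimal⇒Ψ-maximal : ∀ {n m k} {G : Graph n} → BipartiteOptimal n m G → (D : DifferenceGraph G k) → 4 ≤ n →
  ∀ K w ℓ q → Σ₁ k (x D) + Σ₁ k (y D) ≡ Σ₁ K w + q →
  Σ₁ k (λ i → x D i * rowLength D i) ≡ Σ₁ K (λ i → w i * ℓ i) →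
  (∀ i → i < K → 1 ≤ ℓ (suc i) × ℓ (suc i) ≤ q) →
  ∀ i → i < K → 1 ≤ w (suc i) → ℓ (suc i) ≡ q →
  Ψ K w ℓ ≤ Ψ k (x D) (rowLength D)
optimal⇒Ψ-maximal opt D 4≤n K w ℓ zero n≡ m≡ bounds i i<K 1≤w full =
  ⊥-elim (ℕ.<⇒≱ (proj₁ (bounds i i<K)) (proj₂ (bounds i i<K)))
optimal⇒Ψ-maximal {n} {m} {k} {G} ((_ , _ , refl) , min) D 4≤n K w ℓ (suc q) n≡ m≡ bounds i i<K 1≤w full
  with H , (con , bip , mH) , F ← realise {n} K w ℓ q (trans (order≡ D) n≡) bounds i i<K 1≤w full =
  ℕ.*-cancelˡ-≤ 2 (subst₂ _≤_ (Ferrers.closedWalks₄-Ferrers F) (Ferrers.closedWalks₄-Ferrers FG)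
    (a4-≤⇒closedWalks₄-≥ 4≤n G H (sym m′) (min H (con , bip , m′))))
  where
  FG = differenceGraph-Ferrers D
  m′ : edgeCount H ≡ edgeCount G
  m′ = trans mH (trans (sym m≡) (sym (Ferrers.edgeCount-Ferrers FG)))

-- Exchanging columns for rows

prepend : ℕ → (ℕ → ℕ) → ℕ → ℕ
prepend a f zero = 0
prepend a f (suc zero) = a
prepend a f (suc (suc i)) = f (suc i)

-- g is f without its first entry f 1; sequences are indexed from 1, and their entry 0 is junk.
_TailOf_ : (ℕ → ℕ) → (ℕ → ℕ) → Set
g TailOf f = ∀ i → f (suc (suc i)) ≡ g (suc i)

Σ₁-head : ∀ K {f g} → g TailOf f → Σ₁ (suc K) f ≡ f 1 + Σ₁ K g
Σ₁-head zero {f} h = ℕ.+-comm 0 (f 1)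
Σ₁-head (suc K) {f} {g} h = trans (cong₂ _+_ (Σ₁-head K {f} {g} h) (h K)) (ℕ.+-assoc (f 1) (Σ₁ K g) (g (suc K)))

Σ₁-+ : ∀ K f g → Σ₁ K (λ i → f i + g i) ≡ Σ₁ K f + Σ₁ K g
Σ₁-+ zero f g = refl
Σ₁-+ (suc K) f g = trans (cong (λ z → z + (f (suc K) + g (suc K))) (Σ₁-+ K f g))
  (lem (Σ₁ K f) (Σ₁ K g) (f (suc K)) (g (suc K)))
  where
  lem : ∀ a b c d → a + b + (c + d) ≡ a + c + (b + d)
  lem = solveℕ-∀

Σ₁-*ˡ : ∀ K a f → Σ₁ K (λ i → a * f i) ≡ a * Σ₁ K f
Σ₁-*ˡ zero a f = sym (ℕ.*-zeroʳ a)
Σ₁-*ˡ (suc K) a f = trans (cong (λ z → z + a * f (suc K)) (Σ₁-*ˡ K a f)) (sym (ℕ.*-distribˡ-+ a (Σ₁ K f) (f (suc K))))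

length≤Σ₁ : ∀ K f → (∀ i → i < K → 1 ≤ f (suc i)) → K ≤ Σ₁ K f
length≤Σ₁ zero f h = z≤n
length≤Σ₁ (suc K) f h = subst (_≤ Σ₁ (suc K) f) (ℕ.+-comm K 1)
  (ℕ.+-mono-≤ (length≤Σ₁ K f λ i i<K → h i (ℕ.m<n⇒m<1+n i<K)) (h K (ℕ.n<1+n K)))

Φ-suc : ∀ K w w′ ℓ ℓ′ → w′ TailOf w → ℓ′ TailOf ℓ → ∀ a →
  Φ (suc K) w ℓ a ≡ w 1 * sq (a ⊓ ℓ 1) + Φ K w′ ℓ′ a
Φ-suc K w w′ ℓ ℓ′ hw hℓ a = Σ₁-head K λ i → cong₂ (λ u v → u * sq (a ⊓ v)) (hw i) (hℓ i)

-- `Ψ` is a quadratic form in the multiplicities, so a block splits off as its own square, twice its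
-- interaction with the other rows, and the form of the rest. Two shapes with a common tail are
-- compared by peeling off what differs.
Ψ-suc : ∀ K w w′ ℓ ℓ′ → w′ TailOf w → ℓ′ TailOf ℓ →
  Ψ (suc K) w ℓ ≡ w 1 * (w 1 * sq (ℓ 1)) + 2 * (w 1 * Φ K w′ ℓ′ (ℓ 1)) + Ψ K w′ ℓ′
Ψ-suc K w w′ ℓ ℓ′ hw hℓ = begin
  Ψ (suc K) w ℓ
    ≡⟨ Σ₁-head K {g = λ i → w′ i * Φ (suc K) w ℓ (ℓ′ i)} (λ i → cong₂ (λ u v → u * Φ (suc K) w ℓ v) (hw i) (hℓ i)) ⟩
  w 1 * Φ (suc K) w ℓ (ℓ 1) + Σ₁ K (λ i → w′ i * Φ (suc K) w ℓ (ℓ′ i))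
    ≡⟨ cong₂ _+_ (cong (w 1 *_) (trans (Φ-suc K w w′ ℓ ℓ′ hw hℓ (ℓ 1)) (cong (λ z → w 1 * sq z + Φ K w′ ℓ′ (ℓ 1)) (ℕ.⊓-idem (ℓ 1)))))
         (trans (Σ₁-cong K λ i _ → trans (cong (w′ (suc i) *_) (Φ-suc K w w′ ℓ ℓ′ hw hℓ (ℓ′ (suc i)))) (rearrange (suc i)))
           (trans (Σ₁-+ K (λ i → w 1 * (w′ i * sq (ℓ 1 ⊓ ℓ′ i))) (λ i → w′ i * Φ K w′ ℓ′ (ℓ′ i)))
             (cong (_+ Ψ K w′ ℓ′) (Σ₁-*ˡ K (w 1) (λ i → w′ i * sq (ℓ 1 ⊓ ℓ′ i)))))) ⟩
  w 1 * (w 1 * sq (ℓ 1) + Φ K w′ ℓ′ (ℓ 1)) + (w 1 * Φ K w′ ℓ′ (ℓ 1) + Ψ K w′ ℓ′)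
    ≡⟨ lem (w 1) (w 1 * sq (ℓ 1)) (Φ K w′ ℓ′ (ℓ 1)) (Ψ K w′ ℓ′) ⟩
  w 1 * (w 1 * sq (ℓ 1)) + 2 * (w 1 * Φ K w′ ℓ′ (ℓ 1)) + Ψ K w′ ℓ′ ∎
  where
  rearrange : ∀ i → w′ i * (w 1 * sq (ℓ′ i ⊓ ℓ 1) + Φ K w′ ℓ′ (ℓ′ i)) ≡
    w 1 * (w′ i * sq (ℓ 1 ⊓ ℓ′ i)) + w′ i * Φ K w′ ℓ′ (ℓ′ i)
  rearrange i rewrite ℕ.⊓-comm (ℓ′ i) (ℓ 1) = lem₁ (w′ i) (w 1) (sq (ℓ 1 ⊓ ℓ′ i)) (Φ K w′ ℓ′ (ℓ′ i))
    where
    lem₁ : ∀ a b c d → a * (b * c + d) ≡ b * (a * c) + a * d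
    lem₁ = solveℕ-∀
  lem : ∀ w a f p → w * (a + f) + (w * f + p) ≡ w * a + 2 * (w * f) + p
  lem = solveℕ-∀

Φ-below : ∀ K w ℓ a → (∀ i → i < K → a ≤ ℓ (suc i)) → Φ K w ℓ a ≡ sq a * Σ₁ K w
Φ-below K w ℓ a h = trans (Σ₁-cong K λ i i<K → trans (cong (λ z → w (suc i) * sq z) (ℕ.m≤n⇒m⊓n≡m (h i i<K)))
  (ℕ.*-comm (w (suc i)) (sq a))) (Σ₁-*ˡ K (sq a) w)

Φ-above : ∀ K w ℓ a b → (∀ i → i < K → ℓ (suc i) ≤ a) → a ≤ b → Φ K w ℓ b ≡ Φ K w ℓ a
Φ-above K w ℓ a b h a≤b = Σ₁-cong K λ i i<K → cong (λ z → w (suc i) * sq z)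
  (trans (ℕ.m≥n⇒m⊓n≡n (ℕ.≤-trans (h i i<K) a≤b)) (sym (ℕ.m≥n⇒m⊓n≡n (h i i<K))))

cancel-above : ∀ {A B c a b} → A + c * a ≤ B + c * b → A ≡ B → 1 ≤ c → a ≤ b
cancel-above {A} {c = suc c} {a} {b} h refl _ = ℕ.*-cancelˡ-≤ (suc c) (ℕ.+-cancelˡ-≤ A (suc c * a) (suc c * b) h)

module Moves {n m j : ℕ} {G : Graph n} (opt : BipartiteOptimal n m G) (D : DifferenceGraph G (3 + j)) where
  k = 3 + j
  X = x D
  Y = y D
  L = rowLength D

  Y-positive : ∀ i → i < k → 1 ≤ Y (suc i)
  Y-positive i i<k = subst (1 ≤_) (x-swapSides D (suc i)) (x-positive (swapSides D) i i<k)

  X-positive : ∀ i → i < k → 1 ≤ X (suc i)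
  X-positive = x-positive D

  4≤n : 4 ≤ n
  4≤n = ℕ.≤-trans (ℕ.+-mono-≤ {3} {Σ₁ k X} {1}
      (ℕ.≤-trans (ℕ.m≤m+n 3 j) (length≤Σ₁ k X X-positive))
      (ℕ.≤-trans (ℕ.m≤m+n 1 (2 + j)) (length≤Σ₁ k Y Y-positive)))
    (ℕ.≤-reflexive (sym (order≡ D)))

  L-positive : ∀ i → i < k → 1 ≤ L (suc i)
  L-positive i i<k = ℕ.≤-trans (Y-positive 0 (s≤s z≤n)) (Σ₁-mono-≤ Y (ℕ.m<n⇒0<n∸m i<k))

  -- The last columns Y_k are turned into y_k rows of length x₁.
  module LastColumns (s≤q₀ : X 1 ≤ Σ₁ (2 + j) Y) where
    s = X 1
    t = Y k
    q₀ = Σ₁ (2 + j) Y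
    X′ L′ capped : ℕ → ℕ
    X′ i = X (suc i)
    L′ i = L (suc i)
    -- Only the rows of X₁ meet Y_k, so removing Y_k changes only the first length, from q₀ + t to
    -- q₀.
    capped = prepend q₀ L′

    L′≤q₀ : ∀ i → i < 2 + j → L′ (suc i) ≤ q₀
    L′≤q₀ i _ = Σ₁-mono-≤ Y (ℕ.m∸n≤m (2 + j) i)

    -- Both values of `Ψ` contain `base`. The t new rows add 2t · `Φ k X capped s` through their
    -- pairs with old rows; the t removed columns had 2t · s²q₀, since each meets every retained
    -- column in the s rows of X₁.
    Φ-capped : Φ k X capped s ≤ sq s * q₀
    Φ-capped = cancel-above {c = 2 * t}
      -- The full row needed for connectedness comes from X₁, now the second class, whose capped
      -- length is q₀.
      (subst₂ _≤_ new old (optimal⇒Ψ-maximal opt D 4≤n (suc k) (prepend t X) (prepend s capped) q₀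
        n≡ m≡ bounds 1 (s≤s (s≤s z≤n)) (X-positive 0 (s≤s z≤n)) refl))
      refl (ℕ.≤-trans (Y-positive (2 + j) ℕ.≤-refl) (ℕ.m≤m+n t (t + 0)))
      where
      Z = Φ (2 + j) X′ L′ q₀
      U = Ψ (2 + j) X′ L′
      R = Σ₁ (2 + j) (λ i → X′ i * L′ i)
      base : ℕ
      base = t * (t * sq s) + (s * (s * sq q₀) + 2 * (s * Z) + U)
      n≡ : Σ₁ k X + Σ₁ k Y ≡ Σ₁ (suc k) (prepend t X) + q₀
      n≡ = trans (lem (Σ₁ k X) q₀ t) (cong (_+ q₀) (sym (Σ₁-head k {prepend t X} (λ _ → refl))))
        where
        lem : ∀ p q t → p + (q + t) ≡ t + p + q
        lem = solveℕ-∀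
      m≡ : Σ₁ k (λ i → X i * L i) ≡ Σ₁ (suc k) (λ i → prepend t X i * prepend s capped i)
      m≡ = begin
        Σ₁ k (λ i → X i * L i)        ≡⟨ Σ₁-head (2 + j) {λ i → X i * L i} (λ _ → refl) ⟩
        s * (q₀ + t) + R              ≡⟨ lem s q₀ t R ⟩
        t * s + (s * q₀ + R)          ≡⟨ cong (_+_ (t * s)) (Σ₁-head (2 + j) {λ i → X i * capped i} (λ _ → refl)) ⟨
        t * s + Σ₁ k (λ i → X i * capped i)
          ≡⟨ Σ₁-head k {λ i → prepend t X i * prepend s capped i} (λ _ → refl) ⟨
        Σ₁ (suc k) (λ i → prepend t X i * prepend s capped i) ∎
        where
        lem : ∀ s q t r → s * (q + t) + r ≡ t * s + (s * q + r)
        lem = solveℕ-∀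
      bounds : ∀ i → i < suc k → 1 ≤ prepend s capped (suc i) × prepend s capped (suc i) ≤ q₀
      bounds zero _ = X-positive 0 (s≤s z≤n) , s≤q₀
      bounds (suc zero) _ = L-positive 1 (s≤s (s≤s z≤n)) , ℕ.≤-refl
      bounds (suc (suc i)) (s≤s i<k) = L-positive (suc i) i<k , L′≤q₀ i (ℕ.s≤s⁻¹ i<k)
      new : Ψ (suc k) (prepend t X) (prepend s capped) ≡ base + 2 * t * Φ k X capped s
      new = begin
        Ψ (suc k) (prepend t X) (prepend s capped)
          ≡⟨ Ψ-suc k (prepend t X) X (prepend s capped) capped (λ _ → refl) (λ _ → refl) ⟩
        t * (t * sq s) + 2 * (t * Φ k X capped s) + Ψ k X capped
          ≡⟨ cong (_+_ (t * (t * sq s) + 2 * (t * Φ k X capped s))) (Ψ-suc (2 + j) X X′ capped L′ (λ _ → refl) (λ _ → refl)) ⟩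
        t * (t * sq s) + 2 * (t * Φ k X capped s) + (s * (s * sq q₀) + 2 * (s * Z) + U)
          ≡⟨ lem (t * (t * sq s)) t (Φ k X capped s) (s * (s * sq q₀) + 2 * (s * Z) + U) ⟩
        base + 2 * t * Φ k X capped s ∎
        where
        lem : ∀ a t f b → a + 2 * (t * f) + b ≡ a + b + 2 * t * f
        lem = solveℕ-∀
      old : Ψ k X L ≡ base + 2 * t * (sq s * q₀)
      old = begin
        Ψ k X L
          ≡⟨ Ψ-suc (2 + j) X X′ L L′ (λ _ → refl) (λ _ → refl) ⟩
        s * (s * sq (q₀ + t)) + 2 * (s * Φ (2 + j) X′ L′ (q₀ + t)) + U
          ≡⟨ cong (λ z → s * (s * sq (q₀ + t)) + 2 * (s * z) + U) (Φ-above (2 + j) X′ L′ q₀ (q₀ + t) L′≤q₀ (ℕ.m≤m+n q₀ t)) ⟩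
        s * (s * sq (q₀ + t)) + 2 * (s * Z) + U
          ≡⟨ lem s t q₀ Z U ⟩
        base + 2 * t * (sq s * q₀) ∎
        where
        lem : ∀ s t q z u → s * (s * ((q + t) * (q + t))) + 2 * (s * z) + u ≡
          t * (t * (s * s)) + (s * (s * (q * q)) + 2 * (s * z) + u) + 2 * t * (s * s * q)
        lem = solveℕ-∀

  -- Once the columns Y_k are removed, the rows of X₁, …, X_c still have length at least Σ₁ d y.
  longRows≤columns : ∀ c d → c + d ≡ suc k → 2 ≤ c → c ≤ k → X 1 ≤ Σ₁ d Y → Σ₁ c X ≤ Σ₁ (2 + j) Y
  longRows≤columns c d c+d≡ 2≤c c≤k s≤ = ℕ.*-cancelˡ-≤ (sq s) {{ℕ.>-nonZero (ℕ.*-mono-≤ 1≤s 1≤s)}}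
    (ℕ.≤-trans (ℕ.≤-reflexive (sym (Φ-below c X capped s long))) (ℕ.≤-trans (Σ₁-mono-≤ (λ i → X i * sq (s ⊓ capped i)) c≤k) Φ-capped))
    where
    d≡ : d ≡ suc k ∸ c
    d≡ = trans (sym (ℕ.m+n∸m≡n c d)) (cong (_∸ c) c+d≡)
    d≤ : ∀ i → i ≤ c → d ≤ suc k ∸ i
    d≤ i i≤c = subst (_≤ suc k ∸ i) (sym d≡) (ℕ.∸-monoʳ-≤ (suc k) i≤c)
    -- Since c ≥ 2, d is at most k - 1, so s ≤ Σ₁ d Y ≤ q₀ and the new rows fit.
    s≤q₀ : X 1 ≤ Σ₁ (2 + j) Y
    s≤q₀ = ℕ.≤-trans s≤ (Σ₁-mono-≤ Y (d≤ 2 2≤c))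
    open LastColumns s≤q₀
    1≤s : 1 ≤ s
    1≤s = X-positive 0 (s≤s z≤n)
    long : ∀ i → i < c → s ≤ capped (suc i)
    long zero _ = s≤q₀
    long (suc i) i<c = ℕ.≤-trans s≤ (Σ₁-mono-≤ Y (d≤ (2 + i) i<c))

  -- The columns Y_k and Y_{k-1} are turned into rows of lengths x₁ and x₁ + x₂.
  rows≤columns₂ : X 1 + X 2 ≤ Y 1 → Σ₁ k X ≤ Σ₁ (1 + j) Y
  rows≤columns₂ e≤Y₁ = cancel-above
      (subst₂ _≤_ new old (optimal⇒Ψ-maximal opt D 4≤n (2 + k) w ℓ q
        n≡ m≡ bounds 2 (s≤s (s≤s (s≤s z≤n))) (X-positive 0 (s≤s z≤n)) refl))
      refl (ℕ.≤-trans (ℕ.*-mono-≤ {1} {2 * t} (ℕ.*-mono-≤ {1} {2} (s≤s z≤n) (Y-positive (2 + j) ℕ.≤-refl)) (ℕ.*-mono-≤ 1≤s 1≤s))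
             (ℕ.m≤m+n (2 * t * sq s) (2 * r * sq e)))
    where
    s = X 1
    e = X 1 + X 2
    t = Y k
    r = Y (2 + j)
    q = Σ₁ (1 + j) Y
    X″ L″ capped w ℓ : ℕ → ℕ
    X″ i = X (2 + i)
    L″ i = L (2 + i)
    -- Y_{k-1} meets only X₁ and X₂, which also explains the length e = x₁ + x₂ of the rows
    -- replacing it; from X₃ on the rows already have length at most q.
    capped = prepend q (prepend q L″)
    w = prepend t (prepend r X)
    ℓ = prepend s (prepend e capped)
    p = Σ₁ k X
    Z = Φ (1 + j) X″ L″ q
    U = Ψ (1 + j) X″ L″
    R = Σ₁ (1 + j) (λ i → X″ i * L″ i)
    -- The part t²s² + 2trs² + r²e² counts pairs among the new rows and equally pairs among the
    -- removed columns; the rest counts pairs of capped old rows. What remains are mixed pairs: new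
    -- rows with the p old rows, or removed columns with the q retained columns.
    base : ℕ
    base = t * (t * sq s) + 2 * (t * (sq s * r)) + (r * (r * sq e) + (s * (s * sq q) + 2 * (s * (X 2 * sq q + Z)) + (X 2 * (X 2 * sq q) + 2 * (X 2 * Z) + U)))
    1≤s : 1 ≤ s
    1≤s = X-positive 0 (s≤s z≤n)
    s≤e : s ≤ e
    s≤e = ℕ.m≤m+n s (X 2)
    Y₁≤q : Y 1 ≤ q
    Y₁≤q = Σ₁-mono-≤ Y (s≤s z≤n)
    L″≤q : ∀ i → i < 1 + j → L″ (suc i) ≤ q
    L″≤q i _ = Σ₁-mono-≤ Y (ℕ.m∸n≤m (1 + j) i)
    e≤capped : ∀ i → i < k → e ≤ capped (suc i)
    e≤capped zero _ = ℕ.≤-trans e≤Y₁ Y₁≤q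
    e≤capped (suc zero) _ = ℕ.≤-trans e≤Y₁ Y₁≤q
    e≤capped (suc (suc i)) i<k = ℕ.≤-trans e≤Y₁ (Σ₁-mono-≤ Y (ℕ.m<n⇒0<n∸m i<k))
    s≤ℓ : ∀ i → i < suc k → s ≤ prepend e capped (suc i)
    s≤ℓ zero _ = s≤e
    s≤ℓ (suc i) (s≤s i<k) = ℕ.≤-trans s≤e (e≤capped i i<k)
    n≡ : Σ₁ k X + Σ₁ k Y ≡ Σ₁ (2 + k) w + q
    n≡ = trans (lem p q r t) (cong (_+ q) (sym (trans (Σ₁-head (suc k) {w} (λ _ → refl)) (cong (_+_ t) (Σ₁-head k {prepend r X} (λ _ → refl))))))
      where
      lem : ∀ p q r t → p + (q + r + t) ≡ t + (r + p) + q
      lem = solveℕ-∀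
    m≡ : Σ₁ k (λ i → X i * L i) ≡ Σ₁ (2 + k) (λ i → w i * ℓ i)
    m≡ = begin
      Σ₁ k (λ i → X i * L i)
        ≡⟨ trans (Σ₁-head (2 + j) {λ i → X i * L i} (λ _ → refl)) (cong (_+_ (s * L 1)) (Σ₁-head (1 + j) {λ i → X (suc i) * L (suc i)} (λ _ → refl))) ⟩
      s * (q + r + t) + (X 2 * (q + r) + R)
        ≡⟨ lem s (X 2) q r t R ⟩
      t * s + (r * e + (s * q + (X 2 * q + R)))
        ≡⟨ cong (λ z → t * s + (r * e + z)) (trans (Σ₁-head (2 + j) {λ i → X i * capped i} (λ _ → refl))
             (cong (_+_ (s * q)) (Σ₁-head (1 + j) {λ i → X (suc i) * prepend q L″ i} (λ _ → refl)))) ⟨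
      t * s + (r * e + Σ₁ k (λ i → X i * capped i))
        ≡⟨ cong (_+_ (t * s)) (Σ₁-head k {λ i → prepend r X i * prepend e capped i} (λ _ → refl)) ⟨
      t * s + Σ₁ (suc k) (λ i → prepend r X i * prepend e capped i)
        ≡⟨ Σ₁-head (suc k) {λ i → w i * ℓ i} (λ _ → refl) ⟨
      Σ₁ (2 + k) (λ i → w i * ℓ i) ∎
      where
      lem : ∀ s x q r t R → s * (q + r + t) + (x * (q + r) + R) ≡ t * s + (r * (s + x) + (s * q + (x * q + R)))
      lem = solveℕ-∀
    bounds : ∀ i → i < 2 + k → 1 ≤ ℓ (suc i) × ℓ (suc i) ≤ q
    bounds zero _ = 1≤s , ℕ.≤-trans s≤e (ℕ.≤-trans e≤Y₁ Y₁≤q)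
    bounds (suc i) (s≤s i<) = ℕ.≤-trans 1≤s (s≤ℓ i i<) , upper i i<
      where
      upper : ∀ i → i < suc k → prepend e capped (suc i) ≤ q
      upper zero _ = ℕ.≤-trans e≤Y₁ Y₁≤q
      upper (suc zero) _ = ℕ.≤-refl
      upper (suc (suc zero)) _ = ℕ.≤-refl
      upper (suc (suc (suc i))) (s≤s (s≤s (s≤s i<))) = L″≤q i i<
    new : Ψ (2 + k) w ℓ ≡ base + (2 * t * sq s + 2 * r * sq e) * p
    new = begin
      Ψ (2 + k) w ℓ
        ≡⟨ trans (Ψ-suc (suc k) w (prepend r X) ℓ (prepend e capped) (λ _ → refl) (λ _ → refl))
             (cong₂ (λ a b → t * (t * sq s) + 2 * (t * a) + b)
               (trans (Φ-below (suc k) (prepend r X) (prepend e capped) s s≤ℓ) (cong (sq s *_) (Σ₁-head k {prepend r X} (λ _ → refl))))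
               (trans (Ψ-suc k (prepend r X) X (prepend e capped) capped (λ _ → refl) (λ _ → refl)) (cong₂ (λ a b → r * (r * sq e) + 2 * (r * a) + b)
                 (Φ-below k X capped e e≤capped)
                 (trans (Ψ-suc (2 + j) X (X ∘ suc) capped (prepend q L″) (λ _ → refl) (λ _ → refl)) (cong₂ (λ a b → s * (s * sq q) + 2 * (s * a) + b)
                   (trans (Φ-suc (1 + j) (X ∘ suc) X″ (prepend q L″) L″ (λ _ → refl) (λ _ → refl) q) (cong (λ z → X 2 * sq z + Z) (ℕ.⊓-idem q)))
                   (Ψ-suc (1 + j) (X ∘ suc) X″ (prepend q L″) L″ (λ _ → refl) (λ _ → refl))))))) ⟩
      t * (t * sq s) + 2 * (t * (sq s * (r + p))) + (r * (r * sq e) + 2 * (r * (sq e * p)) + Ψcapped)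
        ≡⟨ lem t r p (sq s) (sq e) Ψcapped ⟩
      base + (2 * t * sq s + 2 * r * sq e) * p ∎
      where
      Ψcapped = s * (s * sq q) + 2 * (s * (X 2 * sq q + Z)) + (X 2 * (X 2 * sq q) + 2 * (X 2 * Z) + U)
      lem : ∀ t r p s² e² u → t * (t * s²) + 2 * (t * (s² * (r + p))) + (r * (r * e²) + 2 * (r * (e² * p)) + u) ≡
        t * (t * s²) + 2 * (t * (s² * r)) + (r * (r * e²) + u) + (2 * t * s² + 2 * r * e²) * p
      lem = solveℕ-∀
    old : Ψ k X L ≡ base + (2 * t * sq s + 2 * r * sq e) * q
    old = begin
      Ψ k X L
        ≡⟨ trans (Ψ-suc (2 + j) X (X ∘ suc) L (L ∘ suc) (λ _ → refl) (λ _ → refl)) (cong₂ (λ a b → s * (s * sq (q + r + t)) + 2 * (s * a) + b)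
             (trans (Φ-suc (1 + j) (X ∘ suc) X″ (L ∘ suc) L″ (λ _ → refl) (λ _ → refl) (q + r + t)) (cong₂ (λ z f → X 2 * sq z + f)
               (ℕ.m≥n⇒m⊓n≡n (ℕ.m≤m+n (q + r) t))
               (Φ-above (1 + j) X″ L″ q (q + r + t) L″≤q (ℕ.≤-trans (ℕ.m≤m+n q r) (ℕ.m≤m+n (q + r) t)))))
             (trans (Ψ-suc (1 + j) (X ∘ suc) X″ (L ∘ suc) L″ (λ _ → refl) (λ _ → refl)) (cong (λ f → X 2 * (X 2 * sq (q + r)) + 2 * (X 2 * f) + U)
               (Φ-above (1 + j) X″ L″ q (q + r) L″≤q (ℕ.m≤m+n q r))))) ⟩
      s * (s * sq (q + r + t)) + 2 * (s * (X 2 * sq (q + r) + Z)) + (X 2 * (X 2 * sq (q + r)) + 2 * (X 2 * Z) + U)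
        ≡⟨ lem s (X 2) q r t Z U ⟩
      base + (2 * t * sq s + 2 * r * sq e) * q ∎
      where
      lem : ∀ s x q r t z u →
        s * (s * ((q + r + t) * (q + r + t))) + 2 * (s * (x * ((q + r) * (q + r)) + z)) + (x * (x * ((q + r) * (q + r))) + 2 * (x * z) + u) ≡
        t * (t * (s * s)) + 2 * (t * (s * s * r)) + (r * (r * ((s + x) * (s + x))) + (s * (s * (q * q)) + 2 * (s * (x * (q * q) + z)) + (x * (x * (q * q)) + 2 * (x * z) + u)))
          + (2 * t * (s * s) + 2 * r * ((s + x) * (s + x))) * q
      lem = solveℕ-∀

-- The three cases of the contradiction

theorem4p7 : ∀ {n m k : ℕ} (G : Graph n) → BipartiteOptimal n m G →
    (D : DifferenceGraph G k) → 3 ≤ k →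
    Σ₁ k (x D) ≥ Σ₁ (k ∸ 1) (y D) →
    x D 1 ≥ y D 1 + y D 2
theorem4p7 G opt D (s≤s (s≤s (s≤s (z≤n {j})))) p≥q₀ = ℕ.≮⇒≥ contradictory
  where
  module M = Moves opt D
  module M′ = Moves opt (swapSides D)
  open M using (X; Y; k)
  Σx′ : ∀ c → Σ₁ c (x (swapSides D)) ≡ Σ₁ c Y
  Σx′ c = Σ₁-cong c λ i _ → x-swapSides D (suc i)
  Σy′ : ∀ c → Σ₁ c (y (swapSides D)) ≡ Σ₁ c X
  Σy′ c = Σ₁-cong c λ i _ → y-swapSides D (suc i)
  longColumns≤rows : ∀ c d → c + d ≡ suc k → 2 ≤ c → c ≤ k → Y 1 ≤ Σ₁ d X → Σ₁ c Y ≤ Σ₁ (2 + j) X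
  longColumns≤rows c d c+d≡ 2≤c c≤k h = subst₂ _≤_ (Σx′ c) (Σy′ (2 + j))
    (M′.longRows≤columns c d c+d≡ 2≤c c≤k (subst₂ _≤_ (sym (x-swapSides D 1)) (sym (Σy′ d)) h))
  grows : ∀ c (f : ℕ → ℕ) → 1 ≤ f (suc c) → Σ₁ c f < Σ₁ (suc c) f
  grows c f 1≤ = ℕ.m<m+n (Σ₁ c f) 1≤
  2≤ : ∀ {i} → 2 ≤ 2 + i
  2≤ = s≤s (s≤s z≤n)
  contradictory : X 1 < Y 1 + Y 2 → ⊥
  contradictory s< with ℕ.≤-total (Y 1) (X 1)
  -- Σ₁ k Y ≤ Σ₁ (k - 1) X ≤ Σ₁ (k - 1) Y, although Y_k is nonempty.
  ... | inj₁ y₁≤s = ℕ.<⇒≱ (grows (2 + j) Y (M.Y-positive (2 + j) ℕ.≤-refl)) (ℕ.≤-trans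
    (longColumns≤rows k 1 (ℕ.+-comm k 1) 2≤ ℕ.≤-refl y₁≤s)
    (M.longRows≤columns (2 + j) 2 (ℕ.+-comm (2 + j) 2) 2≤ (ℕ.n≤1+n (2 + j)) (ℕ.<⇒≤ s<)))
  ... | inj₂ s≤y₁ with ℕ.≤-total (X 1 + X 2) (Y 1)
  -- Σ₁ (k - 1) Y ≤ Σ₁ k X ≤ Σ₁ (k - 2) Y, although Y_{k-1} is nonempty.
  ...   | inj₁ e≤y₁ = ℕ.<⇒≱ (grows (1 + j) Y (M.Y-positive (1 + j) (ℕ.n≤1+n (2 + j))))
    (ℕ.≤-trans p≥q₀ (M.rows≤columns₂ e≤y₁))
  -- Σ₁ k X ≤ Σ₁ (k - 1) Y ≤ Σ₁ (k - 1) X, although X_k is nonempty.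
  ...   | inj₂ y₁≤e = ℕ.<⇒≱ (grows (2 + j) X (M.X-positive (2 + j) ℕ.≤-refl)) (ℕ.≤-trans
    (M.longRows≤columns k 1 (ℕ.+-comm k 1) 2≤ ℕ.≤-refl s≤y₁)
    (longColumns≤rows (2 + j) 2 (ℕ.+-comm (2 + j) 2) 2≤ (ℕ.n≤1+n (2 + j)) y₁≤e))
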